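{- For an integer $n\ge 2$, let $J(n,2)$ be the Johnson graph on $\binom{[n]}{2}$. Then \[ \lim_{n\to\infty}\frac{\operatorname{iso}(J(n,2))}{(2-\sqrt{2})\,n}=1, \] that is, $\operatorname{iso}(J(n,2))\sim (2-\sqrt{2})n$.
   Context: For a finite graph $G$ with $N$ vertices and $S\subseteq V(G)$, the boundary $\partial S$ is the set of edges of $G$ with exactly one endpoint in $S$. The isoperimetric number of $G$ is $\operatorname{iso}(G)=\min\{|\partial S|/|S| : S\subseteq V(G),\ 0<|S|\le N/2\}$. For positive integers $k\le n$, the Johnson graph $J(n,k)$ has vertex set $\binom{[n]}{k}$ (all $k$-element subsets of $[n]=\{1,\dots,n\}$), two vertices being adjacent iff their intersection has exactly $k-1$ elements. In particular $J(n,2)$ has $n(n-1)/2$ vertices. -}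

module Defs where

open import Data.Bool using (Bool; true; false; if_then_else_)
open import Data.Nat as ℕ using (ℕ; zero; suc)
open import Data.Integer using (+_)
open import Data.Fin using (Fin; toℕ)
open import Data.Fin.Properties using () renaming (_≟_ to _≟ᶠ_)
open import Data.List using (List; []; _∷_; length; filter; map; concatMap; allFin; cartesianProduct)
open import Data.Product using (_×_; _,_; proj₁; proj₂)
open import Data.Sum using (_⊎_)
open import Data.Rational as ℚ using (ℚ; 0ℚ; 1ℚ; _<_; _≤_; _⊓_)
open import Data.Rational.Properties using () renaming (_≟_ to _≟ℚ_)
open import Relation.Nullary using (yes; no; does)

-- A finite (simple) graph given by a duplicate-free list of all its
-- vertices and a symmetric Boolean adjacency relation.
record FinGraph : Set₁ where
  field
    V     : Set
    verts : List V
    adj   : V → V → Bool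

splits : {A : Set} → List A → List (List A × List A)
splits []       = ( [] , [] ) ∷ []
splits (x ∷ xs) =
  map (λ p → (x ∷ proj₁ p , proj₂ p)) (splits xs) Data.List.++
  map (λ p → (proj₁ p , x ∷ proj₂ p)) (splits xs)

boundarySize : (G : FinGraph) → List (FinGraph.V G) × List (FinGraph.V G) → ℕ
boundarySize G (S , T) =
  length (filter (λ e → FinGraph.adj G (proj₁ e) (proj₂ e) Data.Bool.≟ true)
                 (cartesianProduct S T))

-- |∂S| / |S| as a rational (0 when S is empty; never used then)
ratio : ℕ → ℕ → ℚ
ratio b zero    = 0ℚ
ratio b (suc k) = (+ b) ℚ./ suc k

admissible : ℕ → ℕ → Bool
admissible N zero    = false
admissible N (suc k) = does (2 ℕ.* suc k ℕ.≤? N)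

candidates : (G : FinGraph) → List ℚ
candidates G =
  concatMap (λ p → if admissible (length (FinGraph.verts G)) (length (proj₁ p))
                     then ratio (boundarySize G p) (length (proj₁ p)) ∷ []
                     else [])
            (splits (FinGraph.verts G))

minimum : List ℚ → ℚ
minimum []       = 0ℚ          -- convention: iso := 0 when no admissible S (N < 2)
minimum (q ∷ []) = q
minimum (q ∷ qs@(_ ∷ _)) = q ⊓ minimum qs

iso : FinGraph → ℚ
iso G = minimum (candidates G)

-- 2-subsets {i,j} of [n] represented as ordered pairs (i , j) with i < j
pairs : (n : ℕ) → List (Fin n × Fin n)
pairs n = filter (λ p → toℕ (proj₁ p) ℕ.<? toℕ (proj₂ p))
                 (cartesianProduct (allFin n) (allFin n))

[_≡ᵇ_] : {n : ℕ} → Fin n → Fin n → ℕ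
[ i ≡ᵇ j ] = if does (i ≟ᶠ j) then 1 else 0

-- |{a,b} ∩ {c,d}| (valid since a ≠ b and c ≠ d)
interSize : {n : ℕ} → Fin n × Fin n → Fin n × Fin n → ℕ
interSize (a , b) (c , d) =
  [ a ≡ᵇ c ] ℕ.+ [ a ≡ᵇ d ] ℕ.+ [ b ≡ᵇ c ] ℕ.+ [ b ≡ᵇ d ]

J2 : ℕ → FinGraph
J2 n = record
  { V     = Fin n × Fin n
  ; verts = pairs n
  ; adj   = λ u v → does (interSize u v ℕ.≟ 1)
  }

record ℚ√2 : Set where
  constructor _+_√2
  field
    re : ℚ
    ir : ℚ
open ℚ√2 public

embed : ℚ → ℚ√2
embed q = q + 0ℚ √2

√2 : ℚ√2
√2 = 0ℚ + 1ℚ √2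

_⊕_ : ℚ√2 → ℚ√2 → ℚ√2
(a + b √2) ⊕ (c + d √2) = (a ℚ.+ c) + (b ℚ.+ d) √2

_⊖_ : ℚ√2 → ℚ√2 → ℚ√2
(a + b √2) ⊖ (c + d √2) = (a ℚ.- c) + (b ℚ.- d) √2

_⊗_ : ℚ√2 → ℚ√2 → ℚ√2
(a + b √2) ⊗ (c + d √2) =
  (a ℚ.* c ℚ.+ 2ℚ ℚ.* (b ℚ.* d)) + (a ℚ.* d ℚ.+ b ℚ.* c) √2
  where 2ℚ = 1ℚ ℚ.+ 1ℚ

-- multiplicative inverse: 1/(a+b√2) = (a - b√2)/(a² - 2b²); (0 ↦ 0 by convention)
inv : ℚ√2 → ℚ√2
inv (a + b √2) with (a ℚ.* a ℚ.- (1ℚ ℚ.+ 1ℚ) ℚ.* (b ℚ.* b)) ≟ℚ 0ℚ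
... | yes _  = 0ℚ + 0ℚ √2
... | no ≢0  = (a ℚ.÷ nrm) + (ℚ.- b ℚ.÷ nrm) √2
  where
    nrm = a ℚ.* a ℚ.- (1ℚ ℚ.+ 1ℚ) ℚ.* (b ℚ.* b)
    instance _ = ℚ.≢-nonZero ≢0

_⊘_ : ℚ√2 → ℚ√2 → ℚ√2
x ⊘ y = x ⊗ inv y

-- a + b√2 > 0 (as a real number), decided by the sign analysis
Positive : ℚ√2 → Set
Positive (a + b √2) =
  ((0ℚ < a × 0ℚ ≤ b) ⊎ (0ℚ ≤ a × 0ℚ < b))
  ⊎ ((0ℚ < a × b < 0ℚ × (1ℚ ℚ.+ 1ℚ) ℚ.* (b ℚ.* b) < a ℚ.* a)
  ⊎  (a < 0ℚ × 0ℚ < b × a ℚ.* a < (1ℚ ℚ.+ 1ℚ) ℚ.* (b ℚ.* b)))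

_<ʳ_ : ℚ√2 → ℚ√2 → Set
x <ʳ y = Positive (y ⊖ x)

AbsLt : ℚ√2 → ℚ → Set
AbsLt x ε = (embed (ℚ.- ε) <ʳ x) × (x <ʳ embed ε)

normalisedIso : ℕ → ℚ√2
normalisedIso n =
  embed (iso (J2 n)) ⊘ ((embed (1ℚ ℚ.+ 1ℚ) ⊖ √2) ⊗ embed ((+ n) ℚ./ 1))

-- Identify a set S of vertices of J(n,2) with the graph on [n] whose edges are the
-- elements of S. If d denotes its degrees, y = Σ d = 2|S| and A = Σ d², then two pairs
-- meet in one point precisely when they share a vertex, so |∂S| = Σ d (n - 1 - d)
-- = (n - 1) y - A.
--
-- Lower bound: every graph satisfies A² ≤ y³ or B² ≤ z³, where z = Σ (n - d) and
-- B = Σ (n - d)². Moving an edge vw to uw with d(u) ≥ d(v) increases A, and when no such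
-- move is left the graph has an isolated or a dominating vertex, whose deletion gives an
-- induction on n. For y ≤ z either alternative yields 2A² ≤ n²y², so that
-- |∂S|/|S| ≥ 2(n - 1) - √2 n.
--
-- Upper bound: the k-clique with k maximal such that it has at most half of the pairs has
-- |∂S|/|S| = 2(n - k), and k ~ n/√2.

module Submission where

open import Defs

-- Neither alternative of the disjunction holds for all graphs: a large star violates `A² ≤ y³`, and
-- a large clique together with one isolated vertex violates `B² ≤ z³`. When `y ≤ z` the second
-- alternative follows from the first, when `z ≤ y` the first follows from the second, and at
-- `y = z` they coincide, as then `A = B`. So every graph has one weaker alternative, fixed by its
-- density, and that one is what the induction can maintain. Measuring the complement by `n - d`
-- rather than `n - 1 - d`, that is with loops, makes a looped clique on m vertices an exact
-- equality case: `z = m²`, `B = m³`. It also makes the balance point `y = n²/2`. There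
-- `y^(3/2) = n y/√2`, which is the source of the √2 in the limit. No real numbers occur:
-- inequalities are squared and proved by writing a difference as a sum of products of non-negative
-- terms.

module ℤ≤ where
  open import Data.Integer
  open import Data.Integer.Properties hiding (_≟_)
  open import Data.Integer.Tactic.RingSolver
  import Data.Nat as ℕ
  open import Data.Sum using ([_,_]′)
  open import Data.Empty using (⊥)
  open import Relation.Binary.PropositionalEquality

  -- Integer inequalities from non-negative certificates

  0≤+ : ∀ {i j} → 0ℤ ≤ i → 0ℤ ≤ j → 0ℤ ≤ i + j
  0≤+ = +-mono-≤

  0≤* : ∀ {i j} → 0ℤ ≤ i → 0ℤ ≤ j → 0ℤ ≤ i * j
  0≤* {+ m} {+ n} _ _ = subst (0ℤ ≤_) (pos-* m n) (+≤+ ℕ.z≤n)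

  0≤sq : ∀ i → 0ℤ ≤ i * i
  0≤sq i = [ (λ p → 0≤* p p) , (λ p → subst (0ℤ ≤_) (neg-sq i) (0≤* (neg-mono-≤ p) (neg-mono-≤ p))) ]′ (≤-total 0ℤ i)
    where
    neg-sq : ∀ i → - i * - i ≡ i * i
    neg-sq = solve-∀

  0≤const : ∀ k → 0ℤ ≤ + k
  0≤const k = +≤+ ℕ.z≤n

  -- The certificate scheme: `d` is assembled from visibly non-negative terms, and the equation is a
  -- polynomial identity for the ring solver.
  ≤-by : ∀ {i j d} → 0ℤ ≤ d → j - i ≡ d → i ≤ j
  ≤-by p e = 0≤i-j⇒j≤i (subst (0ℤ ≤_) (sym e) p)

  gap : ∀ {i j} → i ≤ j → 0ℤ ≤ j - i
  gap = i≤j⇒0≤j-i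

  -- The refutation scheme: a negated inequality is turned into `1 + j ≤ i`, and a non-negative
  -- combination of the assumptions then evaluates to -1.
  ≮0 : ∀ {i} → 0ℤ ≤ i → i ≡ -1ℤ → ⊥
  ≮0 () refl

  sq-cancel-≤ : ∀ {i j} → 0ℤ ≤ j → i * i ≤ j * j → i ≤ j
  sq-cancel-≤ {i} {j} 0≤j p = ≮⇒≥ λ j<i → let 1+j≤i = gap (i<j⇒suc[i]≤j j<i) in
    ≮0 (0≤+ (gap p) (0≤+ (0≤* 1+j≤i (0≤+ 1+j≤i (0≤const 2))) (0≤* (0≤const 2) (0≤* (0≤+ 1+j≤i (0≤const 1)) 0≤j))))
       (eq i j)
    where
    eq : ∀ i j → (j * j - i * i) + ((i - (1ℤ + j)) * ((i - (1ℤ + j)) + + 2) + + 2 * (((i - (1ℤ + j)) + 1ℤ) * j)) ≡ -1ℤ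
    eq = solve-∀

  *-cancel-0≤ : ∀ {n i} → 1ℤ ≤ n → 0ℤ ≤ n * i → 0ℤ ≤ i
  *-cancel-0≤ {+ ℕ.suc n} {i} _ p = *-cancelˡ-≤-pos 0ℤ i (+ ℕ.suc n) (subst (_≤ + ℕ.suc n * i) (sym (*-zeroʳ (+ ℕ.suc n))) p)
  *-cancel-0≤ {+ ℕ.zero} (+≤+ ())

  -- The inequality A² ≤ y³ for a graph and for its looped complement

  infix 4 _≤^3/2_
  _≤^3/2_ : ℤ → ℤ → Set
  A ≤^3/2 y = A * A ≤ y * y * y

  -- If y and A are the sums of the degrees and of their squares in a graph on n vertices,
  -- then co n y and co² n A y are the sums of n - d and of (n - d)². These belong to the
  -- complement with a loop at every vertex.
  co : ℤ → ℤ → ℤ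
  co n y = n * n - y

  co² : ℤ → ℤ → ℤ → ℤ
  co² n A y = A + n * (n * n - + 2 * y)

  -- From `A ≤ y^(3/2)` and `2 n √y ≤ n² + y`, the inequality of arithmetic and geometric means.
  -- Unlike the hypothesis it is linear in `A`, so that it can control the cross terms that arise
  -- when sums of squares are squared.
  tangent : ∀ n A y → 0ℤ ≤ n → 0ℤ ≤ y → A ≤^3/2 y → + 2 * A * n ≤ y * (n * n + y)
  tangent n A y 0≤n 0≤y p = sq-cancel-≤ (0≤* 0≤y (0≤+ (0≤sq n) 0≤y))
    (≤-by (0≤+ (0≤* (0≤* (0≤const 4) (0≤sq n)) (gap p)) (0≤sq (y * (n * n - y)))) (eq n A y))
    where
    eq : ∀ n A y → y * (n * n + y) * (y * (n * n + y)) - + 2 * A * n * (+ 2 * A * n) ≡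
      + 4 * (n * n) * (y * y * y - A * A) + y * (n * n - y) * (y * (n * n - y))
    eq = solve-∀

  -- With `z = co n y` and `B = co² n A y`, the slack `z³ - B²` exceeds `y³ - A²` by `z - y` times
  -- the slack in `tangent`.
  flip : ∀ n A y → 0ℤ ≤ n → 0ℤ ≤ y → y ≤ co n y → A ≤^3/2 y → co² n A y ≤^3/2 co n y
  flip n A y 0≤n 0≤y h p =
    ≤-by (0≤+ (gap p) (0≤* (gap h) (gap (tangent n A y 0≤n 0≤y p)))) (eq n A y)
    where
    eq : ∀ n A y → let z = n * n - y; B = A + n * (n * n - + 2 * y) in
      z * z * z - B * B ≡ (y * y * y - A * A) + (z - y) * (y * (n * n + y) - + 2 * A * n)
    eq = solve-∀

  co-involutive : ∀ n y → co n (co n y) ≡ y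
  co-involutive = unfolded
    where
    unfolded : ∀ n y → n * n - (n * n - y) ≡ y
    unfolded = solve-∀

  co²-involutive : ∀ n A y → co² n (co² n A y) (co n y) ≡ A
  co²-involutive = unfolded
    where
    unfolded : ∀ n A y → A + n * (n * n - + 2 * y) + n * (n * n - + 2 * (n * n - y)) ≡ A
    unfolded = solve-∀

  flip⁻¹ : ∀ n A y → 0ℤ ≤ n → 0ℤ ≤ co n y → co n y ≤ y → co² n A y ≤^3/2 co n y → A ≤^3/2 y
  flip⁻¹ n A y 0≤n 0≤z h p =
    subst₂ _≤^3/2_ (co²-involutive n A y) (co-involutive n y)
      (flip n (co² n A y) (co n y) 0≤n 0≤z (subst (co n y ≤_) (sym (co-involutive n y)) h) p)

  -- The disjunction does not mention density, because adding a vertex can carry a graph across the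
  -- balance point `y = co n y`.
  data Bound (n A y : ℤ) : Set where
    direct     : A ≤^3/2 y → Bound n A y
    complement : co² n A y ≤^3/2 co n y → Bound n A y

  -- A vertex isolated in the graph is joined to everything, itself included, in the looped
  -- complement. The identity writes n times the slack as a sum of non-negative terms.
  loop-step : ∀ n A y → 1ℤ ≤ n → 0ℤ ≤ y → 0ℤ ≤ co n y → co n y ≤ y → A ≤^3/2 y →
    A + (+ 2 * y + n * n + + 3 * n + 1ℤ) ≤^3/2 y + (+ 2 * n + 1ℤ)
  loop-step n A y 1≤n 0≤y 0≤z h p = 0≤i-j⇒j≤i (*-cancel-0≤ 1≤n (subst (0ℤ ≤_) (eq n A y) total))
    where
    0≤n = ≤-trans (0≤const 1) 1≤n
    E = + 2 * y + n * n + + 3 * n + 1ℤ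
    0≤E : 0ℤ ≤ E
    0≤E = 0≤+ (0≤+ (0≤+ (0≤* (0≤const 2) 0≤y) (0≤sq n)) (0≤* (0≤const 3) 0≤n)) (0≤const 1)
    4y-n² : 0ℤ ≤ (y - co n y) + + 2 * y
    4y-n² = 0≤+ (gap h) (0≤* (0≤const 2) 0≤y)
    total = 0≤+ (0≤+ (0≤* 0≤n (gap p)) (0≤* 0≤E (gap (tangent n A y 0≤n 0≤y p))))
                (0≤* 0≤z (0≤+ (0≤+ (0≤+ (0≤* 0≤y (gap h)) (0≤* 0≤n 4y-n²))
                                      (0≤+ 0≤y (0≤* (0≤const 2) (0≤sq n)))) 0≤n))
    eq : ∀ n A y → let z = n * n - y; E = + 2 * y + n * n + + 3 * n + 1ℤ in
      n * (y * y * y - A * A) + E * (y * (n * n + y) - + 2 * A * n)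
       + z * (y * (y - z) + n * ((y - z) + + 2 * y) + (y + + 2 * (n * n)) + n)
       ≡ n * ((y + (+ 2 * n + 1ℤ)) * (y + (+ 2 * n + 1ℤ)) * (y + (+ 2 * n + 1ℤ)) - (A + E) * (A + E))
    eq = solve-∀

  -- The new vertex has degree `n` and every old degree rises by one, so the squares gain `n²` plus
  -- the sum of all `2d + 1`. The cross term `2 * A * E` is controlled by `tangent` only after
  -- multiplication by `n`, which is cancelled at the end.
  dominating-step : ∀ n A y → 1ℤ ≤ n → 0ℤ ≤ y → 0ℤ ≤ co n y → co n y ≤ y → A ≤^3/2 y →
    A + (n * n + n + + 2 * y) ≤^3/2 y + + 2 * n
  dominating-step n A y 1≤n 0≤y 0≤z h p = 0≤i-j⇒j≤i (*-cancel-0≤ 1≤n (subst (0ℤ ≤_) (eq n A y) total))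
    where
    0≤n = ≤-trans (0≤const 1) 1≤n
    E = n * n + n + + 2 * y
    0≤E : 0ℤ ≤ E
    0≤E = 0≤+ (0≤+ (0≤sq n) 0≤n) (0≤* (0≤const 2) 0≤y)
    n≤n² : 0ℤ ≤ n * (n - 1ℤ)
    n≤n² = 0≤* 0≤n (gap 1≤n)
    total = 0≤+ (0≤+ (0≤+ (0≤* 0≤n (gap p)) (0≤* 0≤E (gap (tangent n A y 0≤n 0≤y p))))
                     (0≤* 0≤z (0≤+ (0≤+ (0≤* 0≤y (gap h)) (0≤* 0≤n (0≤+ (0≤* (0≤const 2) (gap h)) 0≤y)))
                                   (0≤* (0≤const 4) (0≤sq n)))))
                (0≤+ (0≤+ (0≤* (0≤* (0≤sq n) (0≤sq n)) 0≤n) (0≤* (0≤sq n) (0≤sq n)))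
                     (0≤* (0≤sq n) n≤n²))
    eq : ∀ n A y → let z = n * n - y; E = n * n + n + + 2 * y in
      n * (y * y * y - A * A) + E * (y * (n * n + y) - + 2 * A * n)
       + z * (y * (y - z) + n * (+ 2 * (y - z) + y) + + 4 * (n * n))
       + (n * n * (n * n) * n + n * n * (n * n) + n * n * (n * (n - 1ℤ)))
       ≡ n * ((y + + 2 * n) * (y + + 2 * n) * (y + + 2 * n) - (A + E) * (A + E))
    eq = solve-∀

  -- In the looped complement a vertex that dominates the graph meets nothing but its own loop, so
  -- both sums grow by 1. The slack grows by `3z² + 3z - 2B`, which is non-negative because
  -- `B ≤ z^(3/2)`.
  co-step : ∀ B z → 0ℤ ≤ z → B ≤^3/2 z → B + 1ℤ ≤^3/2 z + 1ℤ
  co-step B z 0≤z p = ≤-by (0≤+ (gap p) (gap 2B≤)) (eq₂ B z)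
    where
    eq₁ : ∀ B z → let R = + 3 * (z * z) + + 3 * z in R * R - + 2 * B * (+ 2 * B) ≡
      + 4 * (z * z * z - B * B) + (+ 9 * (z * z * (z * z)) + (+ 14 * (z * z * z) + + 9 * (z * z)))
    eq₁ = solve-∀
    eq₂ : ∀ B z → (z + 1ℤ) * (z + 1ℤ) * (z + 1ℤ) - (B + 1ℤ) * (B + 1ℤ) ≡
      (z * z * z - B * B) + (+ 3 * (z * z) + + 3 * z - + 2 * B)
    eq₂ = solve-∀
    z³ = 0≤* (0≤sq z) 0≤z
    2B≤ : + 2 * B ≤ + 3 * (z * z) + + 3 * z
    2B≤ = sq-cancel-≤ (0≤+ (0≤* (0≤const 3) (0≤sq z)) (0≤* (0≤const 3) 0≤z))
      (≤-by (0≤+ (0≤* (0≤const 4) (gap p))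
               (0≤+ (0≤* (0≤const 9) (0≤sq (z * z))) (0≤+ (0≤* (0≤const 14) z³) (0≤* (0≤const 9) (0≤sq z)))))
        (eq₁ B z))

  -- Passes from the unknown alternative in `Bound` to the weaker one, which density determines.
  -- `direct-bound` is the dense counterpart.
  complement-bound : ∀ n A y → 0ℤ ≤ n → 0ℤ ≤ y → y ≤ co n y → Bound n A y → co² n A y ≤^3/2 co n y
  complement-bound n A y 0≤n 0≤y h (direct p) = flip n A y 0≤n 0≤y h p
  complement-bound n A y 0≤n 0≤y h (complement p) = p

  direct-bound : ∀ n A y → 0ℤ ≤ n → 0ℤ ≤ co n y → co n y ≤ y → Bound n A y → A ≤^3/2 y
  direct-bound n A y 0≤n 0≤z h (direct p) = p
  direct-bound n A y 0≤n 0≤z h (complement p) = flip⁻¹ n A y 0≤n 0≤z h p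

  -- The case split concerns the density before the vertex is added. In a sparse graph the looped
  -- complement gains a single loop; in a dense one the condition `z ≤ y` leaves room for a full row
  -- of new edges.
  dominating : ∀ n A y → 1ℤ ≤ n → 0ℤ ≤ y → 0ℤ ≤ co n y →
    Bound n A y → Bound (1ℤ + n) (A + (n * n + n + + 2 * y)) (y + + 2 * n)
  dominating n A y 1≤n 0≤y 0≤z bd = [ sparse , dense ]′ (≤-total y (co n y))
    where
    0≤n = ≤-trans (0≤const 1) 1≤n
    B≡ : co² n A y + 1ℤ ≡ co² (1ℤ + n) (A + (n * n + n + + 2 * y)) (y + + 2 * n)
    B≡ = B-eq n A y
      where
      B-eq : ∀ n A y → A + n * (n * n - + 2 * y) + 1ℤ ≡
        A + (n * n + n + + 2 * y) + (1ℤ + n) * ((1ℤ + n) * (1ℤ + n) - + 2 * (y + + 2 * n))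
      B-eq = solve-∀
    z≡ : co n y + 1ℤ ≡ co (1ℤ + n) (y + + 2 * n)
    z≡ = z-eq n y
      where
      z-eq : ∀ n y → n * n - y + 1ℤ ≡ (1ℤ + n) * (1ℤ + n) - (y + + 2 * n)
      z-eq = solve-∀
    sparse : y ≤ co n y → Bound (1ℤ + n) (A + (n * n + n + + 2 * y)) (y + + 2 * n)
    sparse h = complement (subst₂ _≤^3/2_ B≡ z≡ (co-step (co² n A y) (co n y) 0≤z (complement-bound n A y 0≤n 0≤y h bd)))
    dense : co n y ≤ y → Bound (1ℤ + n) (A + (n * n + n + + 2 * y)) (y + + 2 * n)
    dense h = direct (dominating-step n A y 1≤n 0≤y 0≤z h (direct-bound n A y 0≤n 0≤z h bd))

  -- Dual to `dominating`: for a dense graph nothing changes in the direct inequality, while for a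
  -- sparse one the looped complement is dense and gains a full row and a loop.
  isolated : ∀ n A y → 1ℤ ≤ n → 0ℤ ≤ y → 0ℤ ≤ co n y → Bound n A y → Bound (1ℤ + n) A y
  isolated n A y 1≤n 0≤y 0≤z bd = [ sparse , dense ]′ (≤-total y (co n y))
    where
    0≤n = ≤-trans (0≤const 1) 1≤n
    y≡ : co n (co n y) ≡ y
    y≡ = co-involutive n y
    B≡ : co² n A y + (+ 2 * co n y + n * n + + 3 * n + 1ℤ) ≡ co² (1ℤ + n) A y
    B≡ = B-eq n A y
      where
      B-eq : ∀ n A y → A + n * (n * n - + 2 * y) + (+ 2 * (n * n - y) + n * n + + 3 * n + 1ℤ) ≡
        A + (1ℤ + n) * ((1ℤ + n) * (1ℤ + n) - + 2 * y)
      B-eq = solve-∀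
    z≡ : co n y + (+ 2 * n + 1ℤ) ≡ co (1ℤ + n) y
    z≡ = z-eq n y
      where
      z-eq : ∀ n y → n * n - y + (+ 2 * n + 1ℤ) ≡ (1ℤ + n) * (1ℤ + n) - y
      z-eq = solve-∀
    sparse : y ≤ co n y → Bound (1ℤ + n) A y
    sparse h = complement (subst₂ _≤^3/2_ B≡ z≡ (loop-step n (co² n A y) (co n y) 1≤n 0≤z
      (subst (0ℤ ≤_) (sym y≡) 0≤y) (subst (_≤ co n y) (sym y≡) h) (complement-bound n A y 0≤n 0≤y h bd)))
    dense : co n y ≤ y → Bound (1ℤ + n) A y
    dense h = direct (direct-bound n A y 0≤n 0≤z h bd)

  -- Otherwise 8A > 5ny, and then co² n A y is too large for complement-bound.
  sparse-bound : ∀ n A y → 0ℤ ≤ n → 0ℤ ≤ A → 0ℤ ≤ y → y ≤ co n y → Bound n A y →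
    + 2 * (A * A) ≤ n * n * (y * y)
  sparse-bound n A y 0≤n 0≤A 0≤y y≤z bd = ≮⇒≥ λ q → ≮0 (total (i<j⇒suc[i]≤j q)) (eq n A y)
    where
    eq : ∀ n A y → let z = n * n - y; B = A + n * (n * n - + 2 * y) in
      + 4 * (z * z * z - B * B) + + 2 * (+ 2 * (A * A) - (1ℤ + n * n * (y * y)))
      + (n * (z - y) * (+ 8 * A - + 5 * (n * y)) + (y * ((z - y) * (z - y)) + 1ℤ)) ≡ -1ℤ
    eq = solve-∀
    eq′ : ∀ n A y → + 8 * A * (+ 8 * A) - + 5 * (n * y) * (+ 5 * (n * y)) ≡
      + 32 * (+ 2 * (A * A) - (1ℤ + n * n * (y * y))) + (+ 7 * (n * y * (n * y)) + + 32)
    eq′ = solve-∀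
    module _ (big : 1ℤ + n * n * (y * y) ≤ + 2 * (A * A)) where
      -- 5/8 is below 1/√2, since 2 · 25 < 64. The factor 5 is the one for which the terms in
      -- `y²(z - y)` cancel in `eq`.
      5ny≤8A : + 5 * (n * y) ≤ + 8 * A
      5ny≤8A = sq-cancel-≤ (0≤* (0≤const 8) 0≤A)
        (≤-by (0≤+ (0≤* (0≤const 32) (gap big)) (0≤+ (0≤* (0≤const 7) (0≤sq (n * y))) (0≤const 32)))
          (eq′ n A y))
      total : 0ℤ ≤ _
      total = 0≤+ (0≤+ (0≤* (0≤const 4) (gap (complement-bound n A y 0≤n 0≤y y≤z bd))) (0≤* (0≤const 2) (gap big)))
                  (0≤+ (0≤* (0≤* 0≤n (gap y≤z)) (gap 5ny≤8A)) (0≤+ (0≤* 0≤y (0≤sq (co n y - y))) (0≤const 1)))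

-- Sums of squared degrees of graphs

module DegreeSquares where
  open ℤ≤
  open import Defs using ([_≡ᵇ_])
  open import Data.Bool using (if_then_else_)
  open import Data.Integer hiding (_≟_; suc)
  open import Data.Integer.Properties hiding (_≟_)
  open import Data.Integer.Tactic.RingSolver
  import Data.Nat as ℕ
  import Data.Nat.Properties as ℕ
  open import Data.Fin using (Fin; zero; suc; punchIn)
  open import Data.Fin.Properties using (_≟_; punchInᵢ≢i)
  open import Data.Product using (Σ; ∃; _×_; _,_)
  open import Data.Sum using (_⊎_; inj₁; inj₂)
  open import Function using (_∘_)
  open import Relation.Nullary using (yes; no; contradiction)
  open import Relation.Nullary.Decidable using (dec-true; dec-false)
  open import Relation.Binary.PropositionalEquality
  open import Algebra.Properties.Semiring.Sum +-*-semiring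

  private variable
    n : ℕ.ℕ

  δ : Fin n → Fin n → ℤ
  δ i j = + [ i ≡ᵇ j ]

  δ-refl : (i : Fin n) → δ i i ≡ 1ℤ
  δ-refl i = cong (λ b → + (if b then 1 else 0)) (dec-true (i ≟ i) refl)

  δ-≢ : {i j : Fin n} → i ≢ j → δ i j ≡ 0ℤ
  δ-≢ {i = i} {j} i≢j = cong (λ b → + (if b then 1 else 0)) (dec-false (i ≟ j) i≢j)

  δ-sym : (i j : Fin n) → δ i j ≡ δ j i
  δ-sym i j with i ≟ j
  ... | yes refl = sym (δ-refl i)
  ... | no i≢j = sym (δ-≢ (i≢j ∘ sym))

  sum-0 : (f : Fin n → ℤ) → (∀ i → f i ≡ 0ℤ) → sum f ≡ 0ℤ
  sum-0 {n} f p = trans (sum-cong-≗ p) (sum-replicate-zero n)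

  sum-const : ∀ n (c : ℤ) → sum {n} (λ _ → c) ≡ + n * c
  sum-const ℕ.zero c = refl
  sum-const (ℕ.suc n) c = trans (cong (_+_ c) (sum-const n c)) (trans (eq (+ n) c) (cong (_* c) (sym (pos-+ 1 n))))
    where
    eq : ∀ m c → c + m * c ≡ (1ℤ + m) * c
    eq = solve-∀

  sum-≤ : {f g : Fin n → ℤ} → (∀ i → f i ≤ g i) → sum f ≤ sum g
  sum-≤ {ℕ.zero} p = ≤-refl
  sum-≤ {ℕ.suc n} p = +-mono-≤ (p zero) (sum-≤ (p ∘ suc))

  sum-≤-const : (f : Fin n → ℤ) (c : ℤ) → (∀ i → f i ≤ c) → sum f ≤ + n * c
  sum-≤-const {n} f c p = subst (sum f ≤_) (sum-const n c) (sum-≤ p)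

  0≤sum : {f : Fin n → ℤ} → (∀ i → 0ℤ ≤ f i) → 0ℤ ≤ sum f
  0≤sum {ℕ.zero} p = ≤-refl
  0≤sum {ℕ.suc n} p = 0≤+ (p zero) (0≤sum (p ∘ suc))

  sum-- : (f g : Fin n → ℤ) → sum (λ i → f i - g i) ≡ sum f - sum g
  sum-- f g = trans (∑-distrib-+ f (λ i → - g i)) (cong (_+_ (sum f)) (sum-neg g))
    where
    sum-neg : (g : Fin n → ℤ) → sum (λ i → - g i) ≡ - sum g
    sum-neg {ℕ.zero} g = refl
    sum-neg {ℕ.suc n} g = trans (cong (_+_ (- g zero)) (sum-neg (g ∘ suc))) (sym (neg-distrib-+ (g zero) _))

  sum-δ : (i : Fin n) (f : Fin n → ℤ) → sum (λ j → δ i j * f j) ≡ f i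
  sum-δ {ℕ.suc n} zero f = trans (cong (_+_ (1ℤ * f zero)) (sum-0 _ (λ j → *-zeroˡ (f (suc j)))))
    (trans (+-identityʳ _) (*-identityˡ _))
  sum-δ {ℕ.suc n} (suc i) f = trans (cong (_+ sum (λ j → δ (suc i) (suc j) * f (suc j))) (*-zeroˡ (f zero))) (trans (+-identityˡ _) (sum-δ i (f ∘ suc)))

  sum-δ-1 : (i : Fin n) → sum (δ i) ≡ 1ℤ
  sum-δ-1 i = trans (sum-cong-≗ (λ j → sym (*-identityʳ (δ i j)))) (sum-δ i (λ _ → 1ℤ))

  all⊎any : {P Q : Fin n → Set} → (∀ i → P i ⊎ Q i) → (∀ i → P i) ⊎ ∃ Q
  all⊎any {ℕ.zero} pq = inj₁ λ ()
  all⊎any {ℕ.suc n} pq with pq zero | all⊎any (pq ∘ suc)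
  ... | inj₂ q | _ = inj₂ (zero , q)
  ... | inj₁ _ | inj₂ (i , q) = inj₂ (suc i , q)
  ... | inj₁ p | inj₁ ps = inj₁ λ { zero → p ; (suc i) → ps i }

  argmax : (f : Fin (ℕ.suc n) → ℤ) → ∃ λ m → ∀ i → f i ≤ f m
  argmax {ℕ.zero} f = zero , λ { zero → ≤-refl }
  argmax {ℕ.suc n} f with argmax (f ∘ suc)
  ... | m , max with ≤-total (f zero) (f (suc m))
  ...   | inj₁ p = suc m , λ { zero → p ; (suc i) → max i }
  ...   | inj₂ p = zero , λ { zero → ≤-refl ; (suc i) → ≤-trans (max i) p }

  argmin : (f : Fin (ℕ.suc n) → ℤ) → ∃ λ m → ∀ i → f m ≤ f i
  argmin f with argmax (-_ ∘ f)
  ... | m , max = m , λ i → neg-cancel-≤ (max i)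

  -- Graphs, their degrees and the deletion of a vertex

  record Graph (n : ℕ.ℕ) : Set where
    field
      edge    : Fin n → Fin n → ℤ
      edge-01 : ∀ u v → edge u v ≡ 0ℤ ⊎ edge u v ≡ 1ℤ
      edge-sym : ∀ u v → edge u v ≡ edge v u
      loopless : ∀ v → edge v v ≡ 0ℤ

    deg : Fin n → ℤ
    deg v = sum (edge v)

    degreeSum : ℤ
    degreeSum = sum deg

    squareSum : ℤ
    squareSum = sum (λ v → deg v * deg v)

    0≤edge : ∀ u v → 0ℤ ≤ edge u v
    0≤edge u v with edge-01 u v
    ... | inj₁ p = ≤-reflexive (sym p)
    ... | inj₂ p = subst (0ℤ ≤_) (sym p) (0≤const 1)

    edge≤1 : ∀ u v → edge u v ≤ 1ℤ
    edge≤1 u v with edge-01 u v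
    ... | inj₁ p = subst (_≤ 1ℤ) (sym p) (0≤const 1)
    ... | inj₂ p = ≤-reflexive p

    0≤deg : ∀ v → 0ℤ ≤ deg v
    0≤deg v = 0≤sum (0≤edge v)

    deg≤n : ∀ v → deg v ≤ + n
    deg≤n v = ≤-trans (sum-≤-const (edge v) 1ℤ (edge≤1 v)) (≤-reflexive (*-identityʳ (+ n)))

    0≤degreeSum : 0ℤ ≤ degreeSum
    0≤degreeSum = 0≤sum 0≤deg

    0≤co-degreeSum : 0ℤ ≤ co (+ n) degreeSum
    0≤co-degreeSum = gap (sum-≤-const deg (+ n) deg≤n)

    0≤squareSum : 0ℤ ≤ squareSum
    0≤squareSum = 0≤sum (λ v → 0≤sq (deg v))

    squareSum≤n³ : squareSum ≤ + n * (+ n * + n)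
    squareSum≤n³ = sum-≤-const _ (+ n * + n) λ v →
      ≤-by (0≤* (gap (deg≤n v)) (0≤+ (0≤const n) (0≤deg v))) (eq (deg v) (+ n))
      where
      eq : ∀ d m → m * m - d * d ≡ (m - d) * (m + d)
      eq = solve-∀

  open Graph

  _∖_ : Graph (ℕ.suc n) → Fin (ℕ.suc n) → Graph n
  G ∖ v = record
    { edge = λ i j → edge G (punchIn v i) (punchIn v j)
    ; edge-01 = λ i j → edge-01 G (punchIn v i) (punchIn v j)
    ; edge-sym = λ i j → edge-sym G (punchIn v i) (punchIn v j)
    ; loopless = λ i → loopless G (punchIn v i)
    }

  Isolated Dominating : Graph (ℕ.suc n) → Fin (ℕ.suc n) → Set
  Isolated G v = ∀ i → edge G (punchIn v i) v ≡ 0ℤ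
  Dominating G v = ∀ i → edge G (punchIn v i) v ≡ 1ℤ

  deg-remove : (G : Graph (ℕ.suc n)) (v : Fin (ℕ.suc n)) →
    deg G v ≡ sum (λ i → edge G (punchIn v i) v)
  deg-remove G v = trans (sum-remove {i = v} (edge G v))
    (trans (cong₂ _+_ (loopless G v) (sum-cong-≗ (λ i → edge-sym G v (punchIn v i)))) (+-identityˡ _))

  deg-punchIn : (G : Graph (ℕ.suc n)) (v : Fin (ℕ.suc n)) (i : Fin n) →
    deg G (punchIn v i) ≡ edge G (punchIn v i) v + deg (G ∖ v) i
  deg-punchIn G v i = sum-remove {i = v} (edge G (punchIn v i))

  -- The function `f` is the identity for the degree sum and squaring for the sum of squares.
  remove-isolated : (G : Graph (ℕ.suc n)) (v : Fin (ℕ.suc n)) → Isolated G v → (f : ℤ → ℤ) → f 0ℤ ≡ 0ℤ →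
    sum (λ u → f (deg G u)) ≡ sum (λ i → f (deg (G ∖ v) i))
  remove-isolated G v iso f f0 = begin
    sum (λ u → f (deg G u))                                  ≡⟨ sum-remove {i = v} (λ u → f (deg G u)) ⟩
    f (deg G v) + sum (λ i → f (deg G (punchIn v i)))        ≡⟨ cong₂ _+_ (trans (cong f deg≡0) f0) (sum-cong-≗ (λ i → cong f (deg≡ i))) ⟩
    0ℤ + sum (λ i → f (deg (G ∖ v) i))                       ≡⟨ +-identityˡ _ ⟩
    sum (λ i → f (deg (G ∖ v) i))                            ∎
    where
    open ≡-Reasoning
    deg≡0 : deg G v ≡ 0ℤ
    deg≡0 = trans (deg-remove G v) (sum-0 _ iso)
    deg≡ : ∀ i → deg G (punchIn v i) ≡ deg (G ∖ v) i
    deg≡ i = trans (deg-punchIn G v i) (trans (cong (_+ deg (G ∖ v) i) (iso i)) (+-identityˡ _))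

  module _ (G : Graph (ℕ.suc n)) (v : Fin (ℕ.suc n)) (dom : Dominating G v) where
    open ≡-Reasoning
    private
      H = G ∖ v
      deg≡n : deg G v ≡ + n
      deg≡n = trans (deg-remove G v) (trans (sum-cong-≗ dom) (trans (sum-const n 1ℤ) (*-identityʳ (+ n))))
      deg≡ : ∀ i → deg G (punchIn v i) ≡ 1ℤ + deg H i
      deg≡ i = trans (deg-punchIn G v i) (cong (_+ deg H i) (dom i))

    degreeSum-dominating : degreeSum G ≡ degreeSum H + + 2 * + n
    degreeSum-dominating = begin
      sum (deg G)                                        ≡⟨ sum-remove {i = v} (deg G) ⟩
      deg G v + sum (λ i → deg G (punchIn v i))          ≡⟨ cong₂ _+_ deg≡n (sum-cong-≗ deg≡) ⟩
      + n + sum (λ i → 1ℤ + deg H i)                     ≡⟨ cong (_+_ (+ n)) (∑-distrib-+ (λ _ → 1ℤ) (deg H)) ⟩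
      + n + (sum {n} (λ _ → 1ℤ) + degreeSum H)           ≡⟨ cong (λ s → + n + (s + degreeSum H)) (sum-const n 1ℤ) ⟩
      + n + (+ n * 1ℤ + degreeSum H)                     ≡⟨ eq (+ n) (degreeSum H) ⟩
      degreeSum H + + 2 * + n                            ∎
      where
      eq : ∀ m y → m + (m * 1ℤ + y) ≡ y + + 2 * m
      eq = solve-∀

    squareSum-dominating : squareSum G ≡ squareSum H + (+ n * + n + + n + + 2 * degreeSum H)
    squareSum-dominating = begin
      sum (λ u → deg G u * deg G u)
        ≡⟨ sum-remove {i = v} (λ u → deg G u * deg G u) ⟩
      deg G v * deg G v + sum (λ i → deg G (punchIn v i) * deg G (punchIn v i))
        ≡⟨ cong₂ _+_ (cong₂ _*_ deg≡n deg≡n) (sum-cong-≗ λ i → trans (cong₂ _*_ (deg≡ i) (deg≡ i)) (expand (deg H i))) ⟩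
      + n * + n + sum (λ i → deg H i * deg H i + (1ℤ + + 2 * deg H i))
        ≡⟨ cong (_+_ (+ n * + n)) (trans (∑-distrib-+ (λ i → deg H i * deg H i) (λ i → 1ℤ + + 2 * deg H i)) (cong (_+_ (squareSum H)) (∑-distrib-+ (λ _ → 1ℤ) (λ i → + 2 * deg H i)))) ⟩
      + n * + n + (squareSum H + (sum {n} (λ _ → 1ℤ) + sum (λ i → + 2 * deg H i)))
        ≡⟨ cong₂ (λ s t → + n * + n + (squareSum H + (s + t))) (sum-const n 1ℤ) (sym (*-distribˡ-sum (+ 2) (deg H))) ⟩
      + n * + n + (squareSum H + (+ n * 1ℤ + + 2 * degreeSum H))
        ≡⟨ eq (+ n) (squareSum H) (degreeSum H) ⟩
      squareSum H + (+ n * + n + + n + + 2 * degreeSum H) ∎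
      where
      expand : ∀ d → (1ℤ + d) * (1ℤ + d) ≡ d * d + (1ℤ + + 2 * d)
      expand = solve-∀
      eq : ∀ m A y → m * m + (A + (m * 1ℤ + + 2 * y)) ≡ A + (m * m + m + + 2 * y)
      eq = solve-∀

  -- Rewiring edges and the induction on the number of vertices

  Improvement : Graph n → Set
  Improvement {n} G = Σ (Graph n) λ G′ → degreeSum G′ ≡ degreeSum G × 1ℤ + squareSum G ≤ squareSum G′

  -- Replacing the edge vw by uw keeps the degree sum and increases the sum of squares.
  module Rewire (G : Graph n) (u v w : Fin n) (w≢u : w ≢ u)
                (vw : edge G v w ≡ 1ℤ) (uw : edge G u w ≡ 0ℤ) (dv≤du : deg G v ≤ deg G u) where
    open ≡-Reasoning

    w≢v : w ≢ v
    w≢v refl with trans (sym vw) (loopless G v)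
    ... | ()

    u≢v : u ≢ v
    u≢v refl with trans (sym vw) uw
    ... | ()

    shift : Fin n → ℤ
    shift x = δ u x - δ v x

    shift-u : shift u ≡ 1ℤ
    shift-u = cong₂ _-_ (δ-refl u) (δ-≢ (u≢v ∘ sym))
    shift-v : shift v ≡ - 1ℤ
    shift-v = cong₂ _-_ (δ-≢ u≢v) (δ-refl v)
    shift-w : shift w ≡ 0ℤ
    shift-w = cong₂ _-_ (δ-≢ (w≢u ∘ sym)) (δ-≢ (w≢v ∘ sym))

    -- A symmetric correction supported on row and column `w`: the entry at `u` rises by 1 and the
    -- one at `v` falls by 1. As `shift w` is 0, the diagonal is untouched.
    edge′ : Fin n → Fin n → ℤ
    edge′ x y = edge G x y + (δ w y * shift x + δ w x * shift y)

    edge′-sym : ∀ x y → edge′ x y ≡ edge′ y x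
    edge′-sym x y = cong₂ _+_ (edge-sym G x y) (+-comm (δ w y * shift x) (δ w x * shift y))

    edge′-away : ∀ x y → x ≢ w → y ≢ w → edge′ x y ≡ edge G x y
    edge′-away x y x≢w y≢w = trans
      (cong₂ (λ a b → edge G x y + (a * shift x + b * shift y)) (δ-≢ (y≢w ∘ sym)) (δ-≢ (x≢w ∘ sym)))
      (eq (edge G x y) (shift x) (shift y))
      where
      eq : ∀ e a b → e + (0ℤ * a + 0ℤ * b) ≡ e
      eq = solve-∀

    edge′-w : ∀ x → edge′ x w ≡ edge G x w + shift x
    edge′-w x = trans (cong₂ (λ a b → edge G x w + (a * shift x + δ w x * b)) (δ-refl w) shift-w)
      (eq (edge G x w) (shift x) (δ w x))
      where
      eq : ∀ e a b → e + (1ℤ * a + b * 0ℤ) ≡ e + a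
      eq = solve-∀

    edge′-w-01 : ∀ x → edge′ x w ≡ 0ℤ ⊎ edge′ x w ≡ 1ℤ
    edge′-w-01 x with x ≟ u | x ≟ v
    ... | yes refl | _ = inj₂ (trans (edge′-w u) (cong₂ _+_ uw shift-u))
    ... | no _ | yes refl = inj₁ (trans (edge′-w v) (cong₂ _+_ vw shift-v))
    ... | no x≢u | no x≢v = subst (λ e → e ≡ 0ℤ ⊎ e ≡ 1ℤ) (sym same) (edge-01 G x w)
      where
      same : edge′ x w ≡ edge G x w
      same = trans (edge′-w x) (trans (cong (_+_ (edge G x w)) (cong₂ _-_ (δ-≢ (x≢u ∘ sym)) (δ-≢ (x≢v ∘ sym)))) (+-identityʳ _))

    edge′-01 : ∀ x y → edge′ x y ≡ 0ℤ ⊎ edge′ x y ≡ 1ℤ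
    edge′-01 x y with y ≟ w | x ≟ w
    ... | yes refl | _ = edge′-w-01 x
    ... | no _ | yes refl = subst (λ e → e ≡ 0ℤ ⊎ e ≡ 1ℤ) (edge′-sym y w) (edge′-w-01 y)
    ... | no y≢w | no x≢w = subst (λ e → e ≡ 0ℤ ⊎ e ≡ 1ℤ) (sym (edge′-away x y x≢w y≢w)) (edge-01 G x y)

    loopless′ : ∀ x → edge′ x x ≡ 0ℤ
    loopless′ x with x ≟ w
    ... | yes refl = trans (edge′-w w) (cong₂ _+_ (loopless G w) shift-w)
    ... | no x≢w = trans (edge′-away x x x≢w x≢w) (loopless G x)

    G′ : Graph n
    G′ = record { edge = edge′ ; edge-01 = edge′-01 ; edge-sym = edge′-sym ; loopless = loopless′ }

    sum-shift : sum shift ≡ 0ℤ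
    sum-shift = trans (sum-- (δ u) (δ v)) (cong₂ _-_ (sum-δ-1 u) (sum-δ-1 v))

    sum-*shift : (f : Fin n → ℤ) → sum (λ x → shift x * f x) ≡ f u - f v
    sum-*shift f = begin
      sum (λ x → shift x * f x)                              ≡⟨ sum-cong-≗ (λ x → eq (δ u x) (δ v x) (f x)) ⟩
      sum (λ x → δ u x * f x - δ v x * f x)                  ≡⟨ sum-- (λ x → δ u x * f x) _ ⟩
      sum (λ x → δ u x * f x) - sum (λ x → δ v x * f x)      ≡⟨ cong₂ _-_ (sum-δ u f) (sum-δ v f) ⟩
      f u - f v                                              ∎
      where
      eq : ∀ a b c → (a - b) * c ≡ a * c - b * c
      eq = solve-∀

    deg′ : ∀ x → deg G′ x ≡ deg G x + shift x
    deg′ x = begin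
      sum (λ y → edge G x y + (δ w y * shift x + δ w x * shift y))
        ≡⟨ trans (∑-distrib-+ (edge G x) _) (cong (_+_ (deg G x)) (∑-distrib-+ (λ y → δ w y * shift x) _)) ⟩
      deg G x + (sum (λ y → δ w y * shift x) + sum (λ y → δ w x * shift y))
        ≡⟨ cong₂ (λ a b → deg G x + (a + b)) (sum-δ w (λ _ → shift x))
             (trans (sym (*-distribˡ-sum (δ w x) shift)) (cong (δ w x *_) sum-shift)) ⟩
      deg G x + (shift x + δ w x * 0ℤ)
        ≡⟨ eq (deg G x) (shift x) (δ w x) ⟩
      deg G x + shift x ∎
      where
      eq : ∀ a b c → a + (b + c * 0ℤ) ≡ a + b
      eq = solve-∀

    degreeSum′ : degreeSum G′ ≡ degreeSum G
    degreeSum′ = trans (sum-cong-≗ deg′) (trans (∑-distrib-+ (deg G) shift)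
      (trans (cong (_+_ (degreeSum G)) sum-shift) (+-identityʳ _)))

    -- Only two degrees change, `deg u` by +1 and `deg v` by -1, so the increase is
    -- `2 (deg u - deg v) + 2`.
    squareSum′ : squareSum G′ ≡ squareSum G + ((+ 2 * deg G u + 1ℤ) - (+ 2 * deg G v + - 1ℤ))
    squareSum′ = begin
      sum (λ x → deg G′ x * deg G′ x)
        ≡⟨ sum-cong-≗ (λ x → trans (cong₂ _*_ (deg′ x) (deg′ x)) (eq (deg G x) (shift x))) ⟩
      sum (λ x → deg G x * deg G x + shift x * (+ 2 * deg G x + shift x))
        ≡⟨ ∑-distrib-+ (λ x → deg G x * deg G x) _ ⟩
      squareSum G + sum (λ x → shift x * (+ 2 * deg G x + shift x))
        ≡⟨ cong (_+_ (squareSum G)) (sum-*shift (λ x → + 2 * deg G x + shift x)) ⟩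
      squareSum G + ((+ 2 * deg G u + shift u) - (+ 2 * deg G v + shift v))
        ≡⟨ cong₂ (λ a b → squareSum G + ((+ 2 * deg G u + a) - (+ 2 * deg G v + b))) shift-u shift-v ⟩
      squareSum G + ((+ 2 * deg G u + 1ℤ) - (+ 2 * deg G v + - 1ℤ)) ∎
      where
      eq : ∀ d s → (d + s) * (d + s) ≡ d * d + s * (+ 2 * d + s)
      eq = solve-∀

    improvement : Improvement G
    improvement = G′ , degreeSum′ ,
      ≤-by (0≤+ (0≤* (0≤const 2) (gap dv≤du)) (0≤const 1))
        (trans (cong (_- (1ℤ + squareSum G)) squareSum′) (eq (squareSum G) (deg G u) (deg G v)))
      where
      eq : ∀ A a b → A + ((+ 2 * a + 1ℤ) - (+ 2 * b + - 1ℤ)) - (1ℤ + A) ≡ + 2 * (a - b) + 1ℤ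
      eq = solve-∀

  -- If v has maximal degree and u minimal degree among the other vertices, then
  -- either v dominates (when u ~ v), or u is isolated (when not), or some edge
  -- can be rewired towards a vertex of larger degree.
  extremal-or-improvable : (G : Graph (ℕ.suc n)) → ∃ (Isolated G) ⊎ ∃ (Dominating G) ⊎ Improvement G
  extremal-or-improvable {ℕ.zero} G = inj₁ (zero , λ ())
  extremal-or-improvable {ℕ.suc n} G with argmax (deg G)
  ... | v , max with argmin (λ i → deg G (punchIn v i))
  ... | u′ , min = split (edge-01 G u v)
    where
    u = punchIn v u′
    u≢v : u ≢ v
    u≢v = punchInᵢ≢i v u′

    split : edge G u v ≡ 0ℤ ⊎ edge G u v ≡ 1ℤ → ∃ (Isolated G) ⊎ ∃ (Dominating G) ⊎ Improvement G
    split (inj₂ uv) with all⊎any {P = λ i → edge G (punchIn v i) v ≡ 1ℤ} {Q = λ _ → Improvement G} test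
      where
      test : ∀ i → edge G (punchIn v i) v ≡ 1ℤ ⊎ Improvement G
      test i with edge-01 G (punchIn v i) v
      ... | inj₂ p = inj₁ p
      -- The edge between `u` and `v` is handed to this non-neighbour of `v`, whose degree is at
      -- least that of `u` by minimality.
      ... | inj₁ p = inj₂ (Rewire.improvement G (punchIn v i) u v (punchInᵢ≢i v i ∘ sym) uv p (min i))
    ... | inj₁ dom = inj₂ (inj₁ (v , dom))
    ... | inj₂ (_ , imp) = inj₂ (inj₂ imp)
    split (inj₁ uv) with all⊎any {P = λ i → edge G (punchIn u i) u ≡ 0ℤ} {Q = λ _ → Improvement G} test
      where
      test : ∀ i → edge G (punchIn u i) u ≡ 0ℤ ⊎ Improvement G
      test i with edge-01 G (punchIn u i) u
      ... | inj₁ p = inj₁ p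
      -- The edge between `u` and this neighbour is handed to `v`, whose degree is maximal.
      ... | inj₂ p = inj₂ (Rewire.improvement G v (punchIn u i) u u≢v p
                            (trans (edge-sym G v u) uv) (max (punchIn u i)))
    ... | inj₁ isol = inj₁ (u , isol)
    ... | inj₂ (_ , imp) = inj₂ (inj₂ imp)

  -- Rewiring changes squareSum but not degreeSum, and for arbitrary integers Bound is not
  -- monotone in A, hence the A′.
  Bounded : ℤ → ℤ → ℤ → Set
  Bounded n A y = ∃ λ A′ → A ≤ A′ × Bound n A′ y

  -- Squares of degrees sum to at most n³, so an induction on n³ ∸ squareSum G ends
  -- in a graph that cannot be improved.
  improve-until-extremal :
    (∀ (G : Graph (ℕ.suc n)) → ∃ (Isolated G) ⊎ ∃ (Dominating G) → Bounded (+ ℕ.suc n) (squareSum G) (degreeSum G)) →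
    ∀ k (G : Graph (ℕ.suc n)) → + ℕ.suc n * (+ ℕ.suc n * + ℕ.suc n) ≤ squareSum G + + k →
    Bounded (+ ℕ.suc n) (squareSum G) (degreeSum G)
  improve-until-extremal {n} base = search
    where
    N³ = + ℕ.suc n * (+ ℕ.suc n * + ℕ.suc n)

    search : ∀ k (G : Graph (ℕ.suc n)) → N³ ≤ squareSum G + + k → Bounded (+ ℕ.suc n) (squareSum G) (degreeSum G)
    improved : ∀ k (G : Graph (ℕ.suc n)) → N³ ≤ squareSum G + + k → Improvement G →
      Bounded (+ ℕ.suc n) (squareSum G) (degreeSum G)

    search k G p with extremal-or-improvable G
    ... | inj₁ i = base G (inj₁ i)
    ... | inj₂ (inj₁ d) = base G (inj₂ d)
    ... | inj₂ (inj₂ i) = improved k G p i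

    improved ℕ.zero G p (G′ , _ , lt) = contradiction
      (0≤+ (gap p) (0≤+ (gap lt) (gap (squareSum≤n³ G′))))
      λ q → ≮0 q (eq N³ (squareSum G) (squareSum G′))
      where
      eq : ∀ m a b → (a + 0ℤ - m) + ((b - (1ℤ + a)) + (m - b)) ≡ -1ℤ
      eq = solve-∀
    improved (ℕ.suc k) G p (G′ , y≡ , lt) =
      let A′ , A≤A′ , bd = search k G′ (≤-trans p (≤-trans (≤-reflexive step) (+-monoˡ-≤ (+ k) lt)))
      in A′ , ≤-trans (i≤suc[i] (squareSum G)) (≤-trans lt A≤A′) , subst (Bound (+ ℕ.suc n) A′) y≡ bd
      where
      step : squareSum G + + ℕ.suc k ≡ 1ℤ + squareSum G + + k
      step = trans (cong (_+_ (squareSum G)) (pos-+ 1 k)) (eq (squareSum G) (+ k))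
        where
        eq : ∀ a b → a + (1ℤ + b) ≡ 1ℤ + a + b
        eq = solve-∀

  -- The single vertex is treated by hand, because `isolated` and `dominating` need a vertex to
  -- remain after the deletion.
  bounded-suc : ∀ n → (∀ (G : Graph n) → Bounded (+ n) (squareSum G) (degreeSum G)) →
    (G : Graph (ℕ.suc n)) → Bounded (+ ℕ.suc n) (squareSum G) (degreeSum G)
  bounded-suc ℕ.zero _ G = 0ℤ , ≤-reflexive square0 , direct (≤-reflexive (cong (λ y → y * y * y) (sym degree0)))
    where
    deg0 : deg G zero ≡ 0ℤ
    deg0 = trans (+-identityʳ _) (loopless G zero)
    degree0 : degreeSum G ≡ 0ℤ
    degree0 = trans (+-identityʳ _) deg0
    square0 : squareSum G ≡ 0ℤ
    square0 = trans (+-identityʳ _) (cong (λ d → d * d) deg0)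
  bounded-suc m@(ℕ.suc _) bounded G = improve-until-extremal remove ∣ N³ ∣ G
    (≤-trans (≤-reflexive (sym (0≤i⇒+∣i∣≡i (0≤* (0≤const (ℕ.suc m)) (0≤sq (+ ℕ.suc m))))))
      (≤-by (0≤squareSum G) (eq (squareSum G) (+ ∣ N³ ∣))))
    where
    N³ = + ℕ.suc m * (+ ℕ.suc m * + ℕ.suc m)
    1≤m : 1ℤ ≤ + m
    1≤m = +≤+ (ℕ.s≤s ℕ.z≤n)
    eq : ∀ a b → a + b - b ≡ a
    eq = solve-∀

    remove : (H : Graph (ℕ.suc m)) → ∃ (Isolated H) ⊎ ∃ (Dominating H) → Bounded (+ ℕ.suc m) (squareSum H) (degreeSum H)
    remove H (inj₁ (v , isol)) =
      let A′ , A≤A′ , bd = bounded (H ∖ v)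
      in A′ , ≤-trans (≤-reflexive (remove-isolated H v isol (λ d → d * d) refl)) A≤A′ ,
         subst (Bound (+ ℕ.suc m) A′) (sym (remove-isolated H v isol (λ d → d) refl))
           (isolated (+ m) A′ (degreeSum (H ∖ v)) 1≤m (0≤degreeSum (H ∖ v)) (0≤co-degreeSum (H ∖ v)) bd)
    remove H (inj₂ (v , dom)) =
      let A′ , A≤A′ , bd = bounded (H ∖ v)
          E = + m * + m + + m + + 2 * degreeSum (H ∖ v)
      in A′ + E , ≤-trans (≤-reflexive (squareSum-dominating H v dom)) (+-monoˡ-≤ E A≤A′) ,
         subst (Bound (+ ℕ.suc m) (A′ + E)) (sym (degreeSum-dominating H v dom))
           (dominating (+ m) A′ (degreeSum (H ∖ v)) 1≤m (0≤degreeSum (H ∖ v)) (0≤co-degreeSum (H ∖ v)) bd)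

  bounded : (G : Graph n) → Bounded (+ n) (squareSum G) (degreeSum G)
  bounded {ℕ.zero} G = 0ℤ , ≤-refl , direct ≤-refl
  bounded {ℕ.suc n} = bounded-suc n bounded

  degree-square-bound : (G : Graph n) → degreeSum G ≤ co (+ n) (degreeSum G) →
    + 2 * (squareSum G * squareSum G) ≤ + n * + n * (degreeSum G * degreeSum G)
  degree-square-bound {n} G sparse with bounded G
  ... | A′ , A≤A′ , bd = ≤-trans (*-monoˡ-≤-nonNeg (+ 2) square-mono)
      (sparse-bound (+ n) A′ (degreeSum G) (0≤const n) 0≤A′ (0≤degreeSum G) sparse bd)
    where
    0≤A′ = ≤-trans (0≤squareSum G) A≤A′
    square-mono : squareSum G * squareSum G ≤ A′ * A′
    square-mono = ≤-by (0≤* (gap A≤A′) (0≤+ 0≤A′ (0≤squareSum G))) (eq A′ (squareSum G))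
      where
      eq : ∀ a b → a * a - b * b ≡ (a - b) * (a + b)
      eq = solve-∀

-- Edge cuts of J(n,2) in terms of degrees

module EdgeCuts where
  open ℤ≤
  open DegreeSquares
  open import Defs using ([_≡ᵇ_]; interSize; pairs; splits; J2; boundarySize)
  open import Data.Bool using (Bool; true; false; if_then_else_)
  import Data.Bool as Bool
  open import Data.Integer hiding (_≟_; suc)
  open import Data.Integer.Properties hiding (_≟_)
  open import Data.Integer.Tactic.RingSolver
  import Data.Nat as ℕ
  open ℕ using (ℕ)
  import Data.Nat.Properties as ℕ
  open import Data.Fin using (Fin; zero; suc; toℕ)
  open import Data.Fin.Properties using (_≟_; toℕ-injective)
  open import Data.List using (List; []; _∷_; _++_; map; filter; length; tabulate; allFin; cartesianProduct)
  open import Data.List.Membership.Propositional using (_∈_)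
  open import Data.List.Membership.Propositional.Properties using (∈-++⁺ˡ; ∈-++⁺ʳ; ∈-++⁻; ∈-map⁺; ∈-map⁻)
  open import Data.List.Relation.Unary.Any using (here; there)
  open import Data.List.Relation.Unary.All as All using (All)
  open import Data.List.Relation.Unary.All.Properties using (all-filter; ++⁻ˡ; ++⁻ʳ)
  open import Data.List.Relation.Binary.Permutation.Propositional.Properties using (All-resp-↭)
  open import Data.List.Relation.Ternary.Interleaving.Propositional using (Interleaving; []; consˡ; consʳ; toPermutation)
  open import Data.Product using (∃; _×_; _,_; proj₁; proj₂)
  open import Data.Sum using (_⊎_; inj₁; inj₂; [_,_]′)
  open import Function using (_∘_)
  open import Relation.Binary.Definitions using (tri<; tri≈; tri>)
  open import Relation.Nullary using (Dec; does; yes; no; ¬_; contradiction)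
  open import Relation.Nullary.Decidable using (dec-true; dec-false; toSum)
  open import Relation.Unary using (Pred; Decidable)
  open import Relation.Unary.Properties using (∁?)
  open import Relation.Binary.PropositionalEquality
  open import Algebra.Properties.Semiring.Sum +-*-semiring
  open import Level using (0ℓ)

  private variable
    A B : Set
    n : ℕ

  ∑ᴸ : (A → ℤ) → List A → ℤ
  ∑ᴸ f []       = 0ℤ
  ∑ᴸ f (x ∷ xs) = f x + ∑ᴸ f xs

  ∑ᴸ-cong : {f g : A → ℤ} → (∀ x → f x ≡ g x) → ∀ xs → ∑ᴸ f xs ≡ ∑ᴸ g xs
  ∑ᴸ-cong p [] = refl
  ∑ᴸ-cong p (x ∷ xs) = cong₂ _+_ (p x) (∑ᴸ-cong p xs)

  ∑ᴸ-cong-All : {f g : A → ℤ} {xs : List A} → All (λ x → f x ≡ g x) xs → ∑ᴸ f xs ≡ ∑ᴸ g xs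
  ∑ᴸ-cong-All All.[] = refl
  ∑ᴸ-cong-All (p All.∷ ps) = cong₂ _+_ p (∑ᴸ-cong-All ps)

  0≤∑ᴸ : {f : A → ℤ} → (∀ x → 0ℤ ≤ f x) → ∀ xs → 0ℤ ≤ ∑ᴸ f xs
  0≤∑ᴸ p [] = ≤-refl
  0≤∑ᴸ p (x ∷ xs) = 0≤+ (p x) (0≤∑ᴸ p xs)

  ∈⇒≤∑ᴸ : {f : A → ℤ} → (∀ x → 0ℤ ≤ f x) → ∀ {x xs} → x ∈ xs → f x ≤ ∑ᴸ f xs
  ∈⇒≤∑ᴸ {f = f} p {xs = x ∷ xs} (here refl) = ≤-trans (≤-reflexive (sym (+-identityʳ (f x)))) (+-monoʳ-≤ (f x) (0≤∑ᴸ p xs))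
  ∈⇒≤∑ᴸ {f = f} p {xs = x ∷ xs} (there i) = ≤-trans (∈⇒≤∑ᴸ p i)
    (≤-trans (≤-reflexive (sym (+-identityˡ (∑ᴸ f xs)))) (+-monoˡ-≤ (∑ᴸ f xs) (p x)))

  ∑ᴸ-++ : (f : A → ℤ) (xs ys : List A) → ∑ᴸ f (xs ++ ys) ≡ ∑ᴸ f xs + ∑ᴸ f ys
  ∑ᴸ-++ f [] ys = sym (+-identityˡ _)
  ∑ᴸ-++ f (x ∷ xs) ys = trans (cong (_+_ (f x)) (∑ᴸ-++ f xs ys)) (sym (+-assoc (f x) _ _))

  ∑ᴸ-map : (f : B → ℤ) (g : A → B) (xs : List A) → ∑ᴸ f (map g xs) ≡ ∑ᴸ (f ∘ g) xs
  ∑ᴸ-map f g [] = refl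
  ∑ᴸ-map f g (x ∷ xs) = cong (_+_ (f (g x))) (∑ᴸ-map f g xs)

  ∑ᴸ-cartesianProduct : (f : A × B → ℤ) (xs : List A) (ys : List B) →
    ∑ᴸ f (cartesianProduct xs ys) ≡ ∑ᴸ (λ x → ∑ᴸ (λ y → f (x , y)) ys) xs
  ∑ᴸ-cartesianProduct f [] ys = refl
  ∑ᴸ-cartesianProduct f (x ∷ xs) ys = trans (∑ᴸ-++ f (map (x ,_) ys) (cartesianProduct xs ys))
    (cong₂ _+_ (∑ᴸ-map f (x ,_) ys) (∑ᴸ-cartesianProduct f xs ys))

  ∑ᴸ-allFin : (f : Fin n → ℤ) → ∑ᴸ f (allFin n) ≡ sum f
  ∑ᴸ-allFin = go (λ i → i)
    where
    go : ∀ {n} (g : Fin n → A) (f : A → ℤ) → ∑ᴸ f (tabulate g) ≡ sum (f ∘ g)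
    go {n = ℕ.zero} g f = refl
    go {n = ℕ.suc n} g f = cong (_+_ (f (g zero))) (go (g ∘ suc) f)

  ∑ᴸ-sum : (g : A → Fin n → ℤ) (xs : List A) → ∑ᴸ (λ x → sum (g x)) xs ≡ sum (λ i → ∑ᴸ (λ x → g x i) xs)
  ∑ᴸ-sum {n = n} g [] = sym (sum-replicate-zero n)
  ∑ᴸ-sum g (x ∷ xs) = trans (cong (_+_ (sum (g x))) (∑ᴸ-sum g xs)) (sym (∑-distrib-+ (g x) (λ i → ∑ᴸ (λ y → g y i) xs)))

  ∑ᴸ-*ʳ : (f : A → ℤ) (c : ℤ) (xs : List A) → ∑ᴸ (λ x → f x * c) xs ≡ ∑ᴸ f xs * c
  ∑ᴸ-*ʳ f c [] = sym (*-zeroˡ c)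
  ∑ᴸ-*ʳ f c (x ∷ xs) = trans (cong (_+_ (f x * c)) (∑ᴸ-*ʳ f c xs)) (sym (*-distribʳ-+ c (f x) _))

  ∑ᴸ-*ˡ : (c : ℤ) (f : A → ℤ) (xs : List A) → ∑ᴸ (λ x → c * f x) xs ≡ c * ∑ᴸ f xs
  ∑ᴸ-*ˡ c f xs = trans (∑ᴸ-cong (λ x → *-comm c (f x)) xs) (trans (∑ᴸ-*ʳ f c xs) (*-comm _ c))

  ∑ᴸ-const : (c : ℤ) (xs : List A) → ∑ᴸ (λ _ → c) xs ≡ c * + length xs
  ∑ᴸ-const c [] = sym (*-zeroʳ c)
  ∑ᴸ-const c (x ∷ xs) = trans (cong (_+_ c) (∑ᴸ-const c xs)) (trans (eq c (+ length xs)) (cong (c *_) (sym (pos-+ 1 (length xs)))))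
    where
    eq : ∀ c l → c + c * l ≡ c * (1ℤ + l)
    eq = solve-∀

  ∑ᴸ-interleaving : (f : A → ℤ) {xs ys zs : List A} → Interleaving xs ys zs → ∑ᴸ f xs + ∑ᴸ f ys ≡ ∑ᴸ f zs
  ∑ᴸ-interleaving f [] = refl
  ∑ᴸ-interleaving f {x ∷ xs} (consˡ i) = trans (+-assoc (f x) _ _) (cong (_+_ (f x)) (∑ᴸ-interleaving f i))
  ∑ᴸ-interleaving f {xs} {y ∷ ys} (consʳ i) = trans (eq (f y) (∑ᴸ f xs) (∑ᴸ f ys)) (cong (_+_ (f y)) (∑ᴸ-interleaving f i))
    where
    eq : ∀ a b c → b + (a + c) ≡ a + (b + c)
    eq = solve-∀

  𝟙 : {P : Set} → Dec P → ℤ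
  𝟙 p = if does p then 1ℤ else 0ℤ

  𝟙-yes : {P : Set} (p : Dec P) → P → 𝟙 p ≡ 1ℤ
  𝟙-yes p x = cong (if_then 1ℤ else 0ℤ) (dec-true p x)

  𝟙-no : {P : Set} (p : Dec P) → ¬ P → 𝟙 p ≡ 0ℤ
  𝟙-no p x = cong (if_then 1ℤ else 0ℤ) (dec-false p x)

  ∑ᴸ-filter : {P : Pred A 0ℓ} (P? : Decidable P) (f : A → ℤ) (xs : List A) →
    ∑ᴸ f (filter P? xs) ≡ ∑ᴸ (λ x → 𝟙 (P? x) * f x) xs
  ∑ᴸ-filter P? f [] = refl
  ∑ᴸ-filter P? f (x ∷ xs) with does (P? x)
  ... | true = cong₂ _+_ (sym (*-identityˡ (f x))) (∑ᴸ-filter P? f xs)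
  ... | false = trans (∑ᴸ-filter P? f xs) (sym (trans (cong (_+ ∑ᴸ (λ x → 𝟙 (P? x) * f x) xs) (*-zeroˡ (f x))) (+-identityˡ _)))

  -- `Interleaving` is the inductive form of membership in `splits`. It makes sums over `S` and `T`
  -- add up to the sum over all vertices, which encodes that the two parts are complementary.
  splits⇒interleaving : {S T : List A} (xs : List A) → (S , T) ∈ splits xs → Interleaving S T xs
  splits⇒interleaving [] (here refl) = []
  splits⇒interleaving (x ∷ xs) i with ∈-++⁻ (map (λ p → x ∷ proj₁ p , proj₂ p) (splits xs)) i
  ... | inj₁ l with _ , j , refl ← ∈-map⁻ _ l = consˡ (splits⇒interleaving xs j)
  ... | inj₂ r with _ , j , refl ← ∈-map⁻ _ r = consʳ (splits⇒interleaving xs j)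

  interleaving⇒splits : {S T xs : List A} → Interleaving S T xs → (S , T) ∈ splits xs
  interleaving⇒splits [] = here refl
  interleaving⇒splits (consˡ i) = ∈-++⁺ˡ (∈-map⁺ _ (interleaving⇒splits i))
  interleaving⇒splits {xs = x ∷ xs} (consʳ i) = ∈-++⁺ʳ (map (λ p → x ∷ proj₁ p , proj₂ p) (splits xs)) (∈-map⁺ _ (interleaving⇒splits i))

  filter-interleaving : {P : Pred A 0ℓ} (P? : Decidable P) (xs : List A) →
    Interleaving (filter P? xs) (filter (∁? P?) xs) xs
  filter-interleaving P? [] = []
  filter-interleaving P? (x ∷ xs) with does (P? x)
  ... | true = consˡ (filter-interleaving P? xs)
  ... | false = consʳ (filter-interleaving P? xs)

  0≤δ : (i j : Fin n) → 0ℤ ≤ δ i j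
  0≤δ i j = 0≤const [ i ≡ᵇ j ]

  Pair : ℕ → Set
  Pair n = Fin n × Fin n

  Increasing : Pair n → Set
  Increasing (a , b) = toℕ a ℕ.< toℕ b

  incident : Pair n → Fin n → ℤ
  incident (a , b) v = δ a v + δ b v

  -- Tells whether a pair has the ends `v` and `w`, in either order. As a polynomial in `δ` it lets
  -- sums over points collapse by `sum-δ`.
  joins : Fin n → Fin n → Pair n → ℤ
  joins v w (a , b) = δ a v * δ b w + δ b v * δ a w

  0≤joins : (v w : Fin n) (e : Pair n) → 0ℤ ≤ joins v w e
  0≤joins v w (a , b) = 0≤+ (0≤* (0≤δ a v) (0≤δ b w)) (0≤* (0≤δ b v) (0≤δ a w))

  joins-sym : (v w : Fin n) (e : Pair n) → joins v w e ≡ joins w v e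
  joins-sym v w (a , b) = eq (δ a v) (δ b w) (δ b v) (δ a w)
    where
    eq : ∀ p q r s → p * q + r * s ≡ s * r + q * p
    eq = solve-∀

  sum-joins : (v : Fin n) (e : Pair n) → sum (λ w → joins v w e) ≡ incident e v
  sum-joins v (a , b) = begin
    sum (λ w → δ a v * δ b w + δ b v * δ a w)          ≡⟨ ∑-distrib-+ (λ w → δ a v * δ b w) (λ w → δ b v * δ a w) ⟩
    sum (λ w → δ a v * δ b w) + sum (λ w → δ b v * δ a w)
      ≡⟨ cong₂ _+_ (*-distribˡ-sum (δ a v) (δ b)) (*-distribˡ-sum (δ b v) (δ a)) ⟨
    δ a v * sum (δ b) + δ b v * sum (δ a)              ≡⟨ cong₂ (λ s t → δ a v * s + δ b v * t) (sum-δ-1 b) (sum-δ-1 a) ⟩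
    δ a v * 1ℤ + δ b v * 1ℤ                            ≡⟨ cong₂ _+_ (*-identityʳ (δ a v)) (*-identityʳ (δ b v)) ⟩
    δ a v + δ b v                                      ∎
    where open ≡-Reasoning

  sum-incident : (e : Pair n) → sum (incident e) ≡ + 2
  sum-incident (a , b) = trans (∑-distrib-+ (δ a) (δ b)) (cong₂ _+_ (sum-δ-1 a) (sum-δ-1 b))

  -- The inner product of two incidence vectors. In this form the count of crossing edges can be
  -- reorganised by the shared point.
  interSize-incident : (e f : Pair n) → + interSize e f ≡ sum (λ v → incident e v * incident f v)
  interSize-incident (a , b) (c , d) = sym (begin
    sum (λ v → (δ a v + δ b v) * (δ c v + δ d v))
      ≡⟨ sum-cong-≗ (λ v → *-distribʳ-+ (δ c v + δ d v) (δ a v) (δ b v)) ⟩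
    sum (λ v → δ a v * (δ c v + δ d v) + δ b v * (δ c v + δ d v))
      ≡⟨ ∑-distrib-+ (λ v → δ a v * (δ c v + δ d v)) _ ⟩
    sum (λ v → δ a v * (δ c v + δ d v)) + sum (λ v → δ b v * (δ c v + δ d v))
      ≡⟨ cong₂ _+_ (sum-δ a _) (sum-δ b _) ⟩
    (δ c a + δ d a) + (δ c b + δ d b)
      ≡⟨ cong₂ _+_ (cong₂ _+_ (δ-sym c a) (δ-sym d a)) (cong₂ _+_ (δ-sym c b) (δ-sym d b)) ⟩
    (δ a c + δ a d) + (δ b c + δ b d)
      ≡⟨ sym (+-assoc (δ a c + δ a d) (δ b c) (δ b d)) ⟩
    δ a c + δ a d + δ b c + δ b d ∎)
    where open ≡-Reasoning

  _<ᶠ?_ : (i j : Fin n) → Dec (toℕ i ℕ.< toℕ j)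
  i <ᶠ? j = toℕ i ℕ.<? toℕ j

  ∑-pairs : (f : Pair n → ℤ) → ∑ᴸ f (pairs n) ≡ sum (λ a → sum (λ b → 𝟙 (a <ᶠ? b) * f (a , b)))
  ∑-pairs {n} f = begin
    ∑ᴸ f (pairs n)
      ≡⟨ ∑ᴸ-filter _ f (cartesianProduct (allFin n) (allFin n)) ⟩
    ∑ᴸ g (cartesianProduct (allFin n) (allFin n))
      ≡⟨ ∑ᴸ-cartesianProduct g (allFin n) (allFin n) ⟩
    ∑ᴸ (λ a → ∑ᴸ (λ b → g (a , b)) (allFin n)) (allFin n)
      ≡⟨ ∑ᴸ-cong (λ a → ∑ᴸ-allFin (λ b → g (a , b))) (allFin n) ⟩
    ∑ᴸ (λ a → sum (λ b → g (a , b))) (allFin n)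
      ≡⟨ ∑ᴸ-allFin (λ a → sum (λ b → g (a , b))) ⟩
    sum (λ a → sum (λ b → g (a , b))) ∎
    where
    open ≡-Reasoning
    g : Pair n → ℤ
    g (a , b) = 𝟙 (a <ᶠ? b) * f (a , b)

  -- Only `(v , w)` and `(w , v)` contribute, and at most one of them is increasing. The weight `q`
  -- is constant for the complete graph and selects the pairs of the clique later on.
  ∑-pairs-joins : (q : Pair n → ℤ) (v w : Fin n) →
    ∑ᴸ (λ e → q e * joins v w e) (pairs n) ≡ 𝟙 (v <ᶠ? w) * q (v , w) + 𝟙 (w <ᶠ? v) * q (w , v)
  ∑-pairs-joins {n} q v w = begin
    ∑ᴸ (λ e → q e * joins v w e) (pairs n)
      ≡⟨ ∑-pairs (λ e → q e * joins v w e) ⟩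
    sum (λ a → sum (λ b → 𝟙 (a <ᶠ? b) * (q (a , b) * (δ a v * δ b w + δ b v * δ a w))))
      ≡⟨ sum-cong-≗ (λ a → trans (sum-cong-≗ (λ b → rearrange a b)) (trans (∑-distrib-+ (λ b → δ w b * (δ v a * t a b)) _)
           (cong₂ _+_ (sum-δ w (λ b → δ v a * t a b)) (sum-δ v (λ b → δ w a * t a b))))) ⟩
    sum (λ a → δ v a * t a w + δ w a * t a v)
      ≡⟨ trans (∑-distrib-+ (λ a → δ v a * t a w) _) (cong₂ _+_ (sum-δ v (λ a → t a w)) (sum-δ w (λ a → t a v))) ⟩
    t v w + t w v ∎
    where
    open ≡-Reasoning
    t : Fin n → Fin n → ℤ
    t a b = 𝟙 (a <ᶠ? b) * q (a , b)
    eq : ∀ x y p q r s → x * (y * (p * q + r * s)) ≡ q * (p * (x * y)) + r * (s * (x * y))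
    eq = solve-∀
    rearrange : ∀ a b → 𝟙 (a <ᶠ? b) * (q (a , b) * (δ a v * δ b w + δ b v * δ a w)) ≡
      δ w b * (δ v a * t a b) + δ v b * (δ w a * t a b)
    rearrange a b = trans
      (cong (λ s → 𝟙 (a <ᶠ? b) * (q (a , b) * s))
        (cong₂ _+_ (cong₂ _*_ (δ-sym a v) (δ-sym b w)) (cong₂ _*_ (δ-sym b v) (δ-sym a w))))
      (eq (𝟙 (a <ᶠ? b)) (q (a , b)) (δ v a) (δ w b) (δ v b) (δ w a))

  comparable : (v w : Fin n) → 𝟙 (v <ᶠ? w) + 𝟙 (w <ᶠ? v) ≡ 1ℤ - δ v w
  comparable v w with ℕ.<-cmp (toℕ v) (toℕ w)
  ... | tri< v<w v≢w v≯w = trans (cong₂ _+_ (𝟙-yes (v <ᶠ? w) v<w) (𝟙-no (w <ᶠ? v) v≯w)) (cong (_-_ 1ℤ) (sym (δ-≢ (v≢w ∘ cong toℕ))))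
  ... | tri> v≮w v≢w w<v = trans (cong₂ _+_ (𝟙-no (v <ᶠ? w) v≮w) (𝟙-yes (w <ᶠ? v) w<v)) (cong (_-_ 1ℤ) (sym (δ-≢ (v≢w ∘ cong toℕ))))
  ... | tri≈ v≮w v≡w v≯w with refl ← toℕ-injective v≡w = trans (cong₂ _+_ (𝟙-no (v <ᶠ? w) v≮w) (𝟙-no (w <ᶠ? v) v≯w)) (cong (_-_ 1ℤ) (sym (δ-refl v)))

  adjacency : List (Pair n) → Fin n → Fin n → ℤ
  adjacency S v w = ∑ᴸ (joins v w) S

  adjacency-pairs : (v w : Fin n) → adjacency (pairs n) v w ≡ 1ℤ - δ v w
  adjacency-pairs {n} v w = trans (∑ᴸ-cong (λ e → sym (*-identityˡ (joins v w e))) (pairs n))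
    (trans (∑-pairs-joins (λ _ → 1ℤ) v w)
      (trans (cong₂ _+_ (*-identityʳ (𝟙 (v <ᶠ? w))) (*-identityʳ (𝟙 (w <ᶠ? v)))) (comparable v w)))

  0≤i≤1 : ∀ {i} → 0ℤ ≤ i → i ≤ 1ℤ → i ≡ 0ℤ ⊎ i ≡ 1ℤ
  0≤i≤1 {+ 0} _ _ = inj₁ refl
  0≤i≤1 {+ 1} _ _ = inj₂ refl
  0≤i≤1 {+ ℕ.suc (ℕ.suc _)} _ (+≤+ (ℕ.s≤s ()))
  0≤i≤1 { -[1+ _ ]} ()

  module _ {S T : List (Pair n)} (split : Interleaving S T (pairs n)) where

    adjacency-split : ∀ v w → adjacency S v w + adjacency T v w ≡ 1ℤ - δ v w
    adjacency-split v w = trans (∑ᴸ-interleaving (joins v w) split) (adjacency-pairs v w)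

    adjacency≤ : ∀ v w → adjacency S v w ≤ 1ℤ - δ v w
    adjacency≤ v w = ≤-trans (≤-trans (≤-reflexive (sym (+-identityʳ _)))
      (+-monoʳ-≤ (adjacency S v w) (0≤∑ᴸ (0≤joins v w) T))) (≤-reflexive (adjacency-split v w))

    -- The entries are 0 or 1 because those of `S` and `T` are non-negative and add up to those of
    -- the complete graph.
    graph : Graph n
    graph = record
      { edge = adjacency S
      ; edge-01 = λ v w → 0≤i≤1 (0≤∑ᴸ (0≤joins v w) S)
          (≤-trans (adjacency≤ v w) (≤-by (0≤δ v w) (eq (δ v w))))
      ; edge-sym = λ v w → ∑ᴸ-cong (joins-sym v w) S
      ; loopless = λ v → ≤-antisym (≤-trans (adjacency≤ v v) (≤-reflexive (cong (_-_ 1ℤ) (δ-refl v)))) (0≤∑ᴸ (0≤joins v v) S)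
      }
      where
      eq : ∀ d → 1ℤ - (1ℤ - d) ≡ d
      eq = solve-∀

    -- A common pair would be counted twice in the adjacency of its ends, whose total over `S` and
    -- `T` is at most 1.
    disjoint : ∀ {e} → e ∈ S → ¬ e ∈ T
    disjoint {e@(a , b)} e∈S e∈T = ≮0 (0≤+ (gap 2≤) (0≤δ a b)) (eq (adjacency S a b) (adjacency T a b) (δ a b) (adjacency-split a b))
      where
      1≤joins : 1ℤ ≤ joins a b e
      1≤joins = ≤-trans (≤-reflexive (sym (cong₂ (λ s t → s * t + 0ℤ) (δ-refl a) (δ-refl b))))
        (+-monoʳ-≤ (δ a a * δ b b) (0≤* (0≤δ b a) (0≤δ a b)))
      2≤ : + 2 ≤ adjacency S a b + adjacency T a b
      2≤ = +-mono-≤ (≤-trans 1≤joins (∈⇒≤∑ᴸ (0≤joins a b) e∈S)) (≤-trans 1≤joins (∈⇒≤∑ᴸ (0≤joins a b) e∈T))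
      eq : ∀ s t d → s + t ≡ 1ℤ - d → (s + t - + 2) + d ≡ -1ℤ
      eq s t d p = trans (cong (λ u → (u - + 2) + d) p) (eq′ d)
        where
        eq′ : ∀ d → (1ℤ - d - + 2) + d ≡ -1ℤ
        eq′ = solve-∀

  deg-incident : (S : List (Pair n)) (v : Fin n) → sum (adjacency S v) ≡ ∑ᴸ (λ e → incident e v) S
  deg-incident S v = trans (sym (∑ᴸ-sum (λ e w → joins v w e) S)) (∑ᴸ-cong (sum-joins v) S)

  handshake : (S : List (Pair n)) → sum (λ v → sum (adjacency S v)) ≡ + 2 * + length S
  handshake S = trans (sum-cong-≗ (deg-incident S)) (trans (sym (∑ᴸ-sum incident S))
    (trans (∑ᴸ-cong sum-incident S) (∑ᴸ-const (+ 2) S)))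

  deg-complete : (v : Fin n) → sum (λ w → 1ℤ - δ v w) ≡ + n - 1ℤ
  deg-complete {n} v = trans (sum-- (λ _ → 1ℤ) (δ v)) (cong₂ _-_ (trans (sum-const n 1ℤ) (*-identityʳ (+ n))) (sum-δ-1 v))

  deg-split : {S T : List (Pair n)} → Interleaving S T (pairs n) → ∀ v →
    sum (adjacency S v) + sum (adjacency T v) ≡ + n - 1ℤ
  deg-split {S = S} {T} split v = trans (sym (∑-distrib-+ (adjacency S v) (adjacency T v)))
    (trans (sum-cong-≗ (adjacency-split split v)) (deg-complete v))

  length-pairs : ∀ n → + 2 * + length (pairs n) ≡ + n * (+ n - 1ℤ)
  length-pairs n = trans (sym (handshake (pairs n)))
    (trans (sum-cong-≗ λ (v : Fin n) → trans (sum-cong-≗ (adjacency-pairs v)) (deg-complete v)) (sum-const n (+ n - 1ℤ)))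

  -- This allows the adjacency test `interSize e f = 1` to be replaced by the number `interSize e f`
  -- itself, which is bilinear in the incidence vectors. The increasing order excludes a pair and
  -- its reversal.
  interSize≤1 : {e f : Pair n} → Increasing e → Increasing f → e ≢ f → interSize e f ℕ.≤ 1
  interSize≤1 {e = a , b} {c , d} a<b c<d e≢f with a ≟ c | a ≟ d | b ≟ c | b ≟ d
  ... | yes refl | yes refl | _ | _ = contradiction c<d (ℕ.<-irrefl refl)
  ... | yes refl | no _ | yes refl | _ = contradiction a<b (ℕ.<-irrefl refl)
  ... | yes refl | no _ | no _ | yes refl = contradiction refl e≢f
  ... | yes refl | no _ | no _ | no _ = ℕ.≤-refl
  ... | no _ | yes refl | yes refl | _ = contradiction c<d (ℕ.<-asym a<b)
  ... | no _ | yes refl | no _ | yes refl = contradiction a<b (ℕ.<-irrefl refl)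
  ... | no _ | yes refl | no _ | no _ = ℕ.≤-refl
  ... | no _ | no _ | yes refl | yes refl = contradiction c<d (ℕ.<-irrefl refl)
  ... | no _ | no _ | yes refl | no _ = ℕ.≤-refl
  ... | no _ | no _ | no _ | yes refl = ℕ.≤-refl
  ... | no _ | no _ | no _ | no _ = ℕ.z≤n

  indicator-1 : ∀ m → m ℕ.≤ 1 → 𝟙 (does (m ℕ.≟ 1) Bool.≟ true) ≡ + m
  indicator-1 0 _ = refl
  indicator-1 1 _ = refl
  indicator-1 (ℕ.suc (ℕ.suc _)) (ℕ.s≤s ())

  increasing-pairs : ∀ n → All Increasing (pairs n)
  increasing-pairs n = all-filter _ (cartesianProduct (allFin n) (allFin n))

  ∑ᴸ-1 : (xs : List A) → ∑ᴸ (λ _ → 1ℤ) xs ≡ + length xs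
  ∑ᴸ-1 xs = trans (∑ᴸ-const 1ℤ xs) (*-identityˡ _)

  module _ {S T : List (Pair n)} (split : Interleaving S T (pairs n)) where
    open ≡-Reasoning

    private
      increasing : All Increasing (S ++ T)
      increasing = All-resp-↭ (toPermutation split) (increasing-pairs n)

      crossing : ∀ {e f} → e ∈ S → f ∈ T → 𝟙 (does (interSize e f ℕ.≟ 1) Bool.≟ true) ≡ sum (λ v → incident e v * incident f v)
      crossing {e} {f} e∈S f∈T = trans (indicator-1 (interSize e f)
        (interSize≤1 (All.lookup (++⁻ˡ S increasing) e∈S) (All.lookup (++⁻ʳ S increasing) f∈T)
          λ { refl → disjoint split e∈S f∈T })) (interSize-incident e f)

    -- Double counting: every crossing edge has one shared point, and a point `v` is shared by as
    -- many of them as the product of its degrees in `S` and in `T`.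
    boundary-degrees : + boundarySize (J2 n) (S , T) ≡ sum (λ v → sum (adjacency S v) * sum (adjacency T v))
    boundary-degrees = begin
      + boundarySize (J2 n) (S , T)
        ≡⟨ sym (∑ᴸ-1 (filter (λ e → FinGraph.adj (J2 n) (proj₁ e) (proj₂ e) Bool.≟ true) (cartesianProduct S T))) ⟩
      ∑ᴸ (λ _ → 1ℤ) (filter (λ e → FinGraph.adj (J2 n) (proj₁ e) (proj₂ e) Bool.≟ true) (cartesianProduct S T))
        ≡⟨ ∑ᴸ-filter (λ e → FinGraph.adj (J2 n) (proj₁ e) (proj₂ e) Bool.≟ true) (λ _ → 1ℤ) (cartesianProduct S T) ⟩
      ∑ᴸ (λ e → ind (proj₁ e) (proj₂ e) * 1ℤ) (cartesianProduct S T)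
        ≡⟨ trans (∑ᴸ-cong (λ e → *-identityʳ (ind (proj₁ e) (proj₂ e))) (cartesianProduct S T)) (∑ᴸ-cartesianProduct (λ e → ind (proj₁ e) (proj₂ e)) S T) ⟩
      ∑ᴸ (λ e → ∑ᴸ (λ f → ind e f) T) S
        ≡⟨ ∑ᴸ-cong-All (All.tabulate λ {e} e∈S → ∑ᴸ-cong-All (All.tabulate λ {f} f∈T → crossing {e} {f} e∈S f∈T)) ⟩
      ∑ᴸ (λ e → ∑ᴸ (λ f → sum (λ v → incident e v * incident f v)) T) S
        ≡⟨ ∑ᴸ-cong (λ e → trans (∑ᴸ-sum (λ f v → incident e v * incident f v) T)
             (sum-cong-≗ (λ v → ∑ᴸ-*ˡ (incident e v) (λ f → incident f v) T))) S ⟩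
      ∑ᴸ (λ e → sum (λ v → incident e v * degT v)) S
        ≡⟨ trans (∑ᴸ-sum (λ e v → incident e v * degT v) S) (sum-cong-≗ (λ v → ∑ᴸ-*ʳ (λ e → incident e v) (degT v) S)) ⟩
      sum (λ v → ∑ᴸ (λ e → incident e v) S * degT v)
        ≡⟨ sum-cong-≗ (λ v → sym (cong₂ _*_ (deg-incident S v) (deg-incident T v))) ⟩
      sum (λ v → sum (adjacency S v) * sum (adjacency T v)) ∎
      where
      open Defs using (module FinGraph)
      degT : Fin n → ℤ
      degT v = ∑ᴸ (λ f → incident f v) T
      ind : Pair n → Pair n → ℤ
      ind e f = 𝟙 (does (interSize e f ℕ.≟ 1) Bool.≟ true)

    boundary-squareSum : + boundarySize (J2 n) (S , T) ≡
      (+ n - 1ℤ) * Graph.degreeSum (graph split) - Graph.squareSum (graph split)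
    boundary-squareSum = begin
      + boundarySize (J2 n) (S , T)                     ≡⟨ boundary-degrees ⟩
      sum (λ v → d v * sum (adjacency T v))             ≡⟨ sum-cong-≗ (λ v → eq (d v) _ _ (deg-split split v)) ⟩
      sum (λ v → (+ n - 1ℤ) * d v - d v * d v)          ≡⟨ sum-- (λ v → (+ n - 1ℤ) * d v) (λ v → d v * d v) ⟩
      sum (λ v → (+ n - 1ℤ) * d v) - sum (λ v → d v * d v)
        ≡⟨ cong (_- sum (λ v → d v * d v)) (sym (*-distribˡ-sum (+ n - 1ℤ) d)) ⟩
      (+ n - 1ℤ) * sum d - sum (λ v → d v * d v)        ∎
      where
      d : Fin n → ℤ
      d v = sum (adjacency S v)
      eq′ : ∀ a b → a * b ≡ (a + b) * a - a * a
      eq′ = solve-∀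
      eq : ∀ a b c → a + b ≡ c → a * b ≡ c * a - a * a
      eq a b c p = trans (eq′ a b) (cong (λ c → c * a - a * a) p)

  boundary-lower : {S T : List (Pair n)} → Interleaving S T (pairs n) → 2 ℕ.* length S ℕ.≤ length (pairs n) →
    ∃ λ a → 0ℤ ≤ a × a * a ≤ + 2 * (+ n * + n * (+ length S * + length S)) ×
      + boundarySize (J2 n) (S , T) ≡ (+ n - 1ℤ) * (+ 2 * + length S) - a
  boundary-lower {n} {S} {T} split small = squareSum G , 0≤squareSum G , bound ,
    trans (boundary-squareSum split) (cong (λ y → (+ n - 1ℤ) * y - squareSum G) y≡)
    where
    open Graph
    G = graph split
    m = + length S
    y≡ : degreeSum G ≡ + 2 * m
    y≡ = handshake S
    4m≤ : + 4 * m ≤ + n * (+ n - 1ℤ)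
    4m≤ = ≤-trans (≤-reflexive (trans (eq m) (cong (+ 2 *_) (sym (pos-* 2 (length S))))))
      (≤-trans (*-monoˡ-≤-nonNeg (+ 2) (+≤+ small)) (≤-reflexive (length-pairs n)))
      where
      eq : ∀ m → + 4 * m ≡ + 2 * (+ 2 * m)
      eq = solve-∀
    -- Twice the degree sum is `4|S| ≤ n (n - 1)`, which is below `n²`: an admissible set is always
    -- on the sparse side.
    sparse : degreeSum G ≤ co (+ n) (degreeSum G)
    sparse = subst (λ y → y ≤ co (+ n) y) (sym y≡) (≤-by (0≤+ (gap 4m≤) (0≤const n)) (eq (+ n) m))
      where
      eq : ∀ n m → n * n - + 2 * m - + 2 * m ≡ (n * (n - 1ℤ) - + 4 * m) + n
      eq = solve-∀
    bound : squareSum G * squareSum G ≤ + 2 * (+ n * + n * (m * m))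
    bound = *-cancelˡ-≤-pos _ _ (+ 2) (≤-trans (degree-square-bound G sparse)
      (≤-reflexive (trans (cong (λ y → + n * + n * (y * y)) y≡) (eq (+ n) m))))
      where
      eq : ∀ n m → n * n * (+ 2 * m * (+ 2 * m)) ≡ + 2 * (+ 2 * (n * n * (m * m)))
      eq = solve-∀

  -- The edge cut of a clique

  _<ᵏ?_ : (v : Fin n) (k : ℕ) → Dec (toℕ v ℕ.< k)
  v <ᵏ? k = toℕ v ℕ.<? k

  below : ℕ → Fin n → ℤ
  below k v = 𝟙 (v <ᵏ? k)

  sum-below : ∀ n k → k ℕ.≤ n → sum {n} (below k) ≡ + k
  sum-below n ℕ.zero _ = sum-0 {n} (below 0) (λ v → 𝟙-no (v <ᵏ? 0) λ ())
  sum-below (ℕ.suc n) (ℕ.suc k) (ℕ.s≤s k≤n) = trans (cong (_+_ 1ℤ) (sum-below n k k≤n)) (sym (pos-+ 1 k))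

  below-idem : ∀ k (v : Fin n) → below k v * below k v ≡ below k v
  below-idem k v = idem (does (v <ᵏ? k))
    where
    idem : ∀ b → (if b then 1ℤ else 0ℤ) * (if b then 1ℤ else 0ℤ) ≡ (if b then 1ℤ else 0ℤ)
    idem true = refl
    idem false = refl

  module Clique (n k : ℕ) (k≤n : k ℕ.≤ n) where
    open ≡-Reasoning

    -- Pairs are increasing, so a second point below `k` puts both points below `k`; `below-max`
    -- restores the symmetric form.
    inside : (e : Pair n) → Dec (toℕ (proj₂ e) ℕ.< k)
    inside e = proj₂ e <ᵏ? k

    S T : List (Pair n)
    S = filter inside (pairs n)
    T = filter (∁? inside) (pairs n)

    split : Interleaving S T (pairs n)
    split = filter-interleaving inside (pairs n)

    below-max : ∀ (v w : Fin n) → 𝟙 (v <ᶠ? w) * below k w ≡ 𝟙 (v <ᶠ? w) * (below k v * below k w)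
    below-max v w = [ (λ v<w → [ below-both v<w , above v<w ]′ (toSum (w <ᵏ? k))) , incomparable ]′ (toSum (v <ᶠ? w))
      where
      below-both : toℕ v ℕ.< toℕ w → toℕ w ℕ.< k → 𝟙 (v <ᶠ? w) * below k w ≡ 𝟙 (v <ᶠ? w) * (below k v * below k w)
      below-both v<w w<k = cong (𝟙 (v <ᶠ? w) *_) (sym (trans
        (cong (_* below k w) (𝟙-yes (v <ᵏ? k) (ℕ.<-trans v<w w<k))) (*-identityˡ (below k w))))
      above : toℕ v ℕ.< toℕ w → ¬ toℕ w ℕ.< k → 𝟙 (v <ᶠ? w) * below k w ≡ 𝟙 (v <ᶠ? w) * (below k v * below k w)
      above v<w w≮k = cong (𝟙 (v <ᶠ? w) *_) (trans (𝟙-no (w <ᵏ? k) w≮k)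
        (sym (trans (cong (below k v *_) (𝟙-no (w <ᵏ? k) w≮k)) (*-zeroʳ (below k v)))))
      incomparable : ¬ toℕ v ℕ.< toℕ w → 𝟙 (v <ᶠ? w) * below k w ≡ 𝟙 (v <ᶠ? w) * (below k v * below k w)
      incomparable v≮w = trans (cong (_* below k w) (𝟙-no (v <ᶠ? w) v≮w))
        (trans (*-zeroˡ (below k w)) (sym (trans (cong (_* (below k v * below k w)) (𝟙-no (v <ᶠ? w) v≮w)) (*-zeroˡ (below k v * below k w)))))

    adjacency-clique : ∀ v w → adjacency S v w ≡ below k v * below k w - δ v w * below k w
    adjacency-clique v w = begin
      adjacency S v w
        ≡⟨ ∑ᴸ-filter inside (joins v w) (pairs n) ⟩
      ∑ᴸ (λ e → below k (proj₂ e) * joins v w e) (pairs n)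
        ≡⟨ ∑-pairs-joins (λ e → below k (proj₂ e)) v w ⟩
      𝟙 (v <ᶠ? w) * below k w + 𝟙 (w <ᶠ? v) * below k v
        ≡⟨ cong₂ _+_ (below-max v w) (below-max w v) ⟩
      𝟙 (v <ᶠ? w) * (below k v * below k w) + 𝟙 (w <ᶠ? v) * (below k w * below k v)
        ≡⟨ eq₁ (𝟙 (v <ᶠ? w)) (𝟙 (w <ᶠ? v)) (below k v) (below k w) ⟩
      (𝟙 (v <ᶠ? w) + 𝟙 (w <ᶠ? v)) * (below k v * below k w)
        ≡⟨ cong (_* (below k v * below k w)) (comparable v w) ⟩
      (1ℤ - δ v w) * (below k v * below k w)
        ≡⟨ eq₂ (δ v w) (below k v) (below k w) ⟩
      below k v * below k w - δ v w * (below k v * below k w)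
        ≡⟨ cong (_-_ (below k v * below k w)) diagonal ⟩
      below k v * below k w - δ v w * below k w ∎
      where
      eq₁ : ∀ p q a b → p * (a * b) + q * (b * a) ≡ (p + q) * (a * b)
      eq₁ = solve-∀
      eq₂ : ∀ d a b → (1ℤ - d) * (a * b) ≡ a * b - d * (a * b)
      eq₂ = solve-∀
      diagonal : δ v w * (below k v * below k w) ≡ δ v w * below k w
      diagonal = [ equal , distinct ]′ (toSum (v ≟ w))
        where
        equal : v ≡ w → δ v w * (below k v * below k w) ≡ δ v w * below k w
        equal refl = cong (δ v v *_) (below-idem k v)
        distinct : v ≢ w → δ v w * (below k v * below k w) ≡ δ v w * below k w
        distinct v≢w = trans (cong (_* (below k v * below k w)) (δ-≢ v≢w))
          (trans (*-zeroˡ (below k v * below k w)) (sym (trans (cong (_* below k w) (δ-≢ v≢w)) (*-zeroˡ (below k w)))))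

    deg-clique : ∀ v → sum (adjacency S v) ≡ below k v * (+ k - 1ℤ)
    deg-clique v = begin
      sum (adjacency S v)
        ≡⟨ sum-cong-≗ (adjacency-clique v) ⟩
      sum {n} (λ w → below k v * below k w - δ v w * below k w)
        ≡⟨ sum-- {n} (λ w → below k v * below k w) (λ w → δ v w * below k w) ⟩
      sum {n} (λ w → below k v * below k w) - sum (λ w → δ v w * below k w)
        ≡⟨ cong₂ _-_ (sym (*-distribˡ-sum {n} (below k v) (below k))) (sum-δ v (below k)) ⟩
      below k v * sum {n} (below k) - below k v
        ≡⟨ cong (λ s → below k v * s - below k v) (sum-below n k k≤n) ⟩
      below k v * + k - below k v
        ≡⟨ eq (below k v) (+ k) ⟩
      below k v * (+ k - 1ℤ) ∎
      where
      eq : ∀ a b → a * b - a ≡ a * (b - 1ℤ)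
      eq = solve-∀

    degreeSum-clique : Graph.degreeSum (graph split) ≡ + k * (+ k - 1ℤ)
    degreeSum-clique = trans (sum-cong-≗ deg-clique)
      (trans (sym (*-distribʳ-sum {n} (+ k - 1ℤ) (below k))) (cong (_* (+ k - 1ℤ)) (sum-below n k k≤n)))

    squareSum-clique : Graph.squareSum (graph split) ≡ + k * ((+ k - 1ℤ) * (+ k - 1ℤ))
    squareSum-clique = trans (sum-cong-≗ λ v → trans (cong₂ _*_ (deg-clique v) (deg-clique v))
        (trans (eq (below k v) (+ k - 1ℤ)) (cong (_* ((+ k - 1ℤ) * (+ k - 1ℤ))) (below-idem k v))))
      (trans (sym (*-distribʳ-sum {n} ((+ k - 1ℤ) * (+ k - 1ℤ)) (below k))) (cong (_* ((+ k - 1ℤ) * (+ k - 1ℤ))) (sum-below n k k≤n)))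
      where
      eq : ∀ a b → a * b * (a * b) ≡ a * a * (b * b)
      eq = solve-∀

    2length-clique : + 2 * + length S ≡ + k * (+ k - 1ℤ)
    2length-clique = trans (sym (handshake S)) degreeSum-clique

    boundary-clique : + boundarySize (J2 n) (S , T) ≡ + 2 * (+ n - + k) * + length S
    boundary-clique = begin
      + boundarySize (J2 n) (S , T)
        ≡⟨ boundary-squareSum split ⟩
      (+ n - 1ℤ) * Graph.degreeSum (graph split) - Graph.squareSum (graph split)
        ≡⟨ cong₂ (λ y a → (+ n - 1ℤ) * y - a) degreeSum-clique squareSum-clique ⟩
      (+ n - 1ℤ) * (+ k * (+ k - 1ℤ)) - + k * ((+ k - 1ℤ) * (+ k - 1ℤ))
        ≡⟨ eq₁ (+ n) (+ k) ⟩
      (+ n - + k) * (+ k * (+ k - 1ℤ))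
        ≡⟨ cong ((+ n - + k) *_) (sym 2length-clique) ⟩
      (+ n - + k) * (+ 2 * + length S)
        ≡⟨ eq₂ (+ n - + k) (+ length S) ⟩
      + 2 * (+ n - + k) * + length S ∎
      where
      eq₁ : ∀ n k → (n - 1ℤ) * (k * (k - 1ℤ)) - k * ((k - 1ℤ) * (k - 1ℤ)) ≡ (n - k) * (k * (k - 1ℤ))
      eq₁ = solve-∀
      eq₂ : ∀ a b → a * (+ 2 * b) ≡ + 2 * a * b
      eq₂ = solve-∀

-- Rational estimates and signs in ℚ√2

module Estimates where
  open import Defs using (ℚ√2; embed; √2; _⊖_; _⊗_; inv; Positive; AbsLt; normalisedIso; iso; J2)
    renaming (_+_√2 to ⟨_,_⟩)
  open import Data.Integer using (+_)
  import Data.Integer as ℤ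
  import Data.Integer.Properties as ℤ
  import Data.Nat as ℕ
  import Data.Nat.Properties as ℕ
  open import Data.Rational hiding (Positive)
  open import Data.Rational.Properties
  import Data.Rational.Unnormalised as ℚᵘ
  import Data.Rational.Unnormalised.Properties as ℚᵘ
  open import Data.Product using (_,_)
  open import Data.Sum using (inj₁; inj₂; [_,_]′)
  open import Level using (0ℓ)
  open import Relation.Binary.Definitions using (Tri; tri<; tri≈; tri>)
  open import Relation.Nullary using (yes; no; contradiction)
  open import Relation.Nullary.Decidable using (dec⇒maybe)
  open import Relation.Binary.PropositionalEquality
  open import Tactic.RingSolver using (solve-∀)
  open import Tactic.RingSolver.Core.AlmostCommutativeRing using (AlmostCommutativeRing; fromCommutativeRing)

  ℚ-ring : AlmostCommutativeRing 0ℓ 0ℓ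
  ℚ-ring = fromCommutativeRing +-*-commutativeRing λ q → dec⇒maybe (0ℚ ≟ q)

  2ℚ 3ℚ 4ℚ 5ℚ 8ℚ ¼ 3/2 : ℚ
  2ℚ = 1ℚ + 1ℚ
  3ℚ = + 3 / 1
  4ℚ = + 4 / 1
  5ℚ = + 5 / 1
  8ℚ = + 8 / 1
  ¼ = + 1 / 4
  3/2 = + 3 / 2

  0≤+ : ∀ {p q} → 0ℚ ≤ p → 0ℚ ≤ q → 0ℚ ≤ p + q
  0≤+ = +-mono-≤

  0<+ : ∀ {p q} → 0ℚ < p → 0ℚ ≤ q → 0ℚ < p + q
  0<+ = +-mono-<-≤

  0≤* : ∀ {p q} → 0ℚ ≤ p → 0ℚ ≤ q → 0ℚ ≤ p * q
  0≤* {p} {q} 0≤p 0≤q = nonNegative⁻¹ _ {{nonNeg*nonNeg⇒nonNeg p {{nonNegative 0≤p}} q {{nonNegative 0≤q}}}}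

  0<* : ∀ {p q} → 0ℚ < p → 0ℚ < q → 0ℚ < p * q
  0<* {p} {q} 0<p 0<q = subst (_< p * q) (*-zeroʳ p) (*-monoʳ-<-pos p {{positive 0<p}} 0<q)

  0≤sq : ∀ p → 0ℚ ≤ p * p
  0≤sq p = [ (λ 0≤p → 0≤* 0≤p 0≤p) , (λ p≤0 → subst (0ℚ ≤_) (neg-sq p) (0≤* (neg-antimono-≤ p≤0) (neg-antimono-≤ p≤0))) ]′ (≤-total 0ℚ p)
    where
    neg-sq : ∀ p → - p * - p ≡ p * p
    neg-sq = solve-∀ ℚ-ring

  0<2ℚ : 0ℚ < 2ℚ
  0<2ℚ = positive⁻¹ 2ℚ
  0<½ : 0ℚ < ½
  0<½ = positive⁻¹ ½

  gap : ∀ {p q} → p ≤ q → 0ℚ ≤ q - p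
  gap {p} {q} p≤q = subst (_≤ q - p) (+-inverseʳ p) (+-monoˡ-≤ (- p) p≤q)

  gap< : ∀ {p q} → p < q → 0ℚ < q - p
  gap< {p} {q} p<q = subst (_< q - p) (+-inverseʳ p) (+-monoˡ-< (- p) p<q)

  cancel-gap : ∀ p q → (q - p) + p ≡ q
  cancel-gap = solve-∀ ℚ-ring

  ≤-by : ∀ {p q d} → 0ℚ ≤ d → q - p ≡ d → p ≤ q
  ≤-by {p} {q} 0≤d e = subst₂ _≤_ (+-identityˡ p) (cancel-gap p q) (+-monoˡ-≤ p (subst (0ℚ ≤_) (sym e) 0≤d))

  <-by : ∀ {p q d} → 0ℚ < d → q - p ≡ d → p < q
  <-by {p} {q} 0<d e = subst₂ _<_ (+-identityˡ p) (cancel-gap p q) (+-monoˡ-< p (subst (0ℚ <_) (sym e) 0<d))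

  -- Here `ι` is 1/n, `α` is the sum of squared degrees divided by `n|S|` for an optimal set, and
  -- `ρ` is the isoperimetric number divided by `n`. The normalised quotient is `ρ (1 + √2/2)`, to
  -- be compared with `1 - ε`. The error `μ` comes from `n - 1` in place of `n`.
  module LowerEstimate {ι ε α : ℚ} (0<ι : 0ℚ < ι) (0<ε : 0ℚ < ε) (8ι≤ε : 8ℚ * ι ≤ ε) (8ι≤ε² : 8ℚ * ι ≤ ε * ε) (8ι≤1 : 8ℚ * ι ≤ 1ℚ)
                       (0≤α : 0ℚ ≤ α) (α²≤2 : α * α ≤ 2ℚ) where
    ρ s t μ : ℚ
    ρ = 2ℚ - 2ℚ * ι - α
    s = α - 1ℚ
    μ = 2ℚ * ι
    t = ε - μ

    0<μ : 0ℚ < μ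
    0<μ = 0<* 0<2ℚ 0<ι

    α≤3/2 : α ≤ 3/2
    α≤3/2 = ≮⇒≥ λ 3/2<α → <-irrefl (eq α) (0<+ (positive⁻¹ ¼)
      (0≤+ (gap α²≤2) (0≤+ (0≤sq (α - 3/2)) (0≤* (nonNegative⁻¹ 3ℚ) (gap (<⇒≤ 3/2<α))))))
      where
      eq : ∀ α → 0ℚ ≡ ¼ + ((2ℚ - α * α) + ((α - 3/2) * (α - 3/2) + 3ℚ * (α - 3/2)))
      eq = solve-∀ ℚ-ring

    -- From `α ≤ 3/2` and `2ι ≤ 1/4` at least 1/4 remains.
    0<ρ : 0ℚ < ρ
    0<ρ = subst (0ℚ <_) (eq ι α) (0<+ (positive⁻¹ ¼) (0≤+ (gap α≤3/2) (0≤* (nonNegative⁻¹ ¼) (gap 8ι≤1))))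
      where
      eq : ∀ ι α → ¼ + ((3/2 - α) + ¼ * (1ℚ - 8ℚ * ι)) ≡ 2ℚ - 2ℚ * ι - α
      eq = solve-∀ ℚ-ring

    0<½ρ : 0ℚ < ½ * ρ
    0<½ρ = 0<* 0<½ 0<ρ

    0≤t : 0ℚ ≤ t
    0≤t = subst (0ℚ ≤_) (eq ε ι) (0≤+ (gap 8ι≤ε) (0≤* (nonNegative⁻¹ (+ 6 / 1)) (<⇒≤ 0<ι)))
      where
      eq : ∀ ε ι → (ε - 8ℚ * ι) + (+ 6 / 1) * ι ≡ ε - 2ℚ * ι
      eq = solve-∀ ℚ-ring

    μ≤t² : μ ≤ t * t
    μ≤t² = ≤-by (0≤+ (0≤* (<⇒≤ 0<½) (0≤* (<⇒≤ 0<ε) (gap 8ι≤ε))) (0≤+ (0≤* (<⇒≤ 0<½) (gap 8ι≤ε²))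
        (0≤+ (0≤* (<⇒≤ 0<2ℚ) (<⇒≤ 0<ι)) (0≤sq (2ℚ * ι))))) (eq ε ι)
      where
      eq : ∀ ε ι → (ε - 2ℚ * ι) * (ε - 2ℚ * ι) - 2ℚ * ι ≡
        ½ * (ε * (ε - 8ℚ * ι)) + (½ * (ε * ε - 8ℚ * ι) + (2ℚ * ι + 2ℚ * ι * (2ℚ * ι)))
      eq = solve-∀ ℚ-ring

    positive-lower : Positive (⟨ ρ - 1ℚ - - ε , ½ * ρ ⟩)
    positive-lower = by-sign (<-cmp (ρ - 1ℚ - - ε) 0ℚ)
      where
      eq₁ : ∀ ι ε α → 0ℚ - (2ℚ - 2ℚ * ι - α - 1ℚ - - ε) ≡ (α - 1ℚ) - (ε - 2ℚ * ι)
      eq₁ = solve-∀ ℚ-ring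
      eq₂ : ∀ ι ε α → let ρ = 2ℚ - 2ℚ * ι - α; s = α - 1ℚ; μ = 2ℚ * ι; t = ε - μ; re = ρ - 1ℚ - - ε in
        2ℚ * (½ * ρ * (½ * ρ)) - re * re ≡
        ½ * (μ * μ + ((2ℚ - α * α) + (2ℚ * ((s - t) + t) * μ + (4ℚ * (t * (s - t)) + 2ℚ * (t * t - μ)))))
      eq₂ = solve-∀ ℚ-ring
      by-sign : Tri (ρ - 1ℚ - - ε < 0ℚ) (ρ - 1ℚ - - ε ≡ 0ℚ) (ρ - 1ℚ - - ε > 0ℚ) → Positive (⟨ ρ - 1ℚ - - ε , ½ * ρ ⟩)
      by-sign (tri≈ _ re≡0 _) = inj₁ (inj₂ (≤-reflexive (sym re≡0) , 0<½ρ))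
      by-sign (tri> _ _ 0<re) = inj₁ (inj₂ (<⇒≤ 0<re , 0<½ρ))
      -- The rational part is `-(s - t)`, so its square must stay below `ρ²/2`. With `ρ = 1 - s - μ`
      -- the difference reduces to the slack in `α² ≤ 2`, and the loss caused by `μ` is absorbed by
      -- `t²`.
      by-sign (tri< re<0 _ _) = inj₂ (inj₂ (re<0 , 0<½ρ , <-by (0<* 0<½ (0<+ (0<* 0<μ 0<μ) rest)) (eq₂ ι ε α)))
        where
        0≤s-t : 0ℚ ≤ s - t
        0≤s-t = <⇒≤ (subst (0ℚ <_) (eq₁ ι ε α) (gap< re<0))
        rest = 0≤+ (gap α²≤2) (0≤+ (0≤* (0≤* (<⇒≤ 0<2ℚ) (0≤+ 0≤s-t 0≤t)) (<⇒≤ 0<μ))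
          (0≤+ (0≤* (nonNegative⁻¹ 4ℚ) (0≤* 0≤t 0≤s-t)) (0≤* (<⇒≤ 0<2ℚ) (gap μ≤t²))))

  -- Here `κ` is k/n for the clique, and `1 ≤ 2κ² + 3ι` says that it is hardly below 1/√2. The claim
  -- amounts to `1 + ε - ρ > 0` and `(1 + ε - ρ)² > ρ²/2`. At `ρ = 2 - 2κ` the difference of the two
  -- sides is `ε² + 2ε(2κ - 1) + 2κ² - 1`; since `8ι ≤ ε²`, the loss of `3ι` leaves `5ι`.
  positive-upper : ∀ {ι ε κ ρ} → 0ℚ < ι → 0ℚ < ε → 8ℚ * ι ≤ ε * ε → κ ≤ 1ℚ → 1ℚ ≤ 2ℚ * κ → 1ℚ ≤ 2ℚ * (κ * κ) + 3ℚ * ι →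
    0ℚ < ρ → ρ ≤ 2ℚ - 2ℚ * κ → Positive (⟨ ε - (ρ - 1ℚ) , - (½ * ρ) ⟩)
  positive-upper {ι} {ε} {κ} {ρ} 0<ι 0<ε 8ι≤ε² κ≤1 1≤2κ 1≤ 0<ρ ρ≤ = inj₂ (inj₁
    ( subst (0ℚ <_) (eq₁ ε κ ρ) (0<+ 0<ε (0≤+ (gap 1≤2κ) (gap ρ≤)))
    , neg-antimono-< (0<* 0<½ 0<ρ)
    , <-by (0<+ (0<* (positive⁻¹ 5ℚ) 0<ι) (0≤+ (gap 8ι≤ε²) (0≤+ (0≤* (<⇒≤ (0<* 0<2ℚ 0<ε)) (gap 1≤2κ)) (0≤+ (gap 1≤)
        (0≤+ (0≤* (0≤* (<⇒≤ 0<2ℚ) (0≤+ (<⇒≤ 0<ε) (gap 1≤2κ))) (gap ρ≤))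
          (0≤+ (0≤* (0≤* (<⇒≤ 0<2ℚ) (gap κ≤1)) (gap ρ≤)) (0≤* (<⇒≤ 0<½) (0≤sq (2ℚ - 2ℚ * κ - ρ)))))))))
        (eq₂ ι ε κ ρ)))
    where
    eq₁ : ∀ ε κ ρ → ε + ((2ℚ * κ - 1ℚ) + (2ℚ - 2ℚ * κ - ρ)) ≡ ε - (ρ - 1ℚ)
    eq₁ = solve-∀ ℚ-ring
    eq₂ : ∀ ι ε κ ρ → let D = 2ℚ - 2ℚ * κ - ρ in
      (ε - (ρ - 1ℚ)) * (ε - (ρ - 1ℚ)) - 2ℚ * (- (½ * ρ) * - (½ * ρ)) ≡
      5ℚ * ι + ((ε * ε - 8ℚ * ι) + (2ℚ * ε * (2ℚ * κ - 1ℚ) + ((2ℚ * (κ * κ) + 3ℚ * ι - 1ℚ) +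
        (2ℚ * (ε + (2ℚ * κ - 1ℚ)) * D + (2ℚ * (1ℚ - κ) * D + ½ * (D * D))))))
    eq₂ = solve-∀ ℚ-ring

  -- Integers and reciprocals in ℚ and ℚ√2

  fromℤ : ℤ.ℤ → ℚ
  fromℤ i = i / 1

  toℚᵘ-/ : ∀ i d → toℚᵘ (i / ℕ.suc d) ℚᵘ.≃ ℚᵘ.mkℚᵘ i d
  toℚᵘ-/ i d = toℚᵘ-fromℚᵘ (ℚᵘ.mkℚᵘ i d)

  fromℤ-+ : ∀ i j → fromℤ (i ℤ.+ j) ≡ fromℤ i + fromℤ j
  fromℤ-+ i j = toℚᵘ-injective (ℚᵘ.≃-trans (toℚᵘ-/ (i ℤ.+ j) 0) (ℚᵘ.≃-sym (ℚᵘ.≃-trans (toℚᵘ-homo-+ (fromℤ i) (fromℤ j))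
    (ℚᵘ.≃-trans (ℚᵘ.+-cong (toℚᵘ-/ i 0) (toℚᵘ-/ j 0))
      (ℚᵘ.*≡* (cong (ℤ._* + 1) (cong₂ ℤ._+_ (ℤ.*-identityʳ i) (ℤ.*-identityʳ j))))))))

  fromℤ-* : ∀ i j → fromℤ (i ℤ.* j) ≡ fromℤ i * fromℤ j
  fromℤ-* i j = toℚᵘ-injective (ℚᵘ.≃-trans (toℚᵘ-/ (i ℤ.* j) 0) (ℚᵘ.≃-sym (ℚᵘ.≃-trans (toℚᵘ-homo-* (fromℤ i) (fromℤ j))
    (ℚᵘ.*-cong (toℚᵘ-/ i 0) (toℚᵘ-/ j 0)))))

  fromℤ-neg : ∀ i → fromℤ (ℤ.- i) ≡ - fromℤ i
  fromℤ-neg i = toℚᵘ-injective (ℚᵘ.≃-trans (toℚᵘ-/ (ℤ.- i) 0) (ℚᵘ.≃-sym (ℚᵘ.≃-trans (toℚᵘ-homo‿- (fromℤ i)) (ℚᵘ.-‿cong (toℚᵘ-/ i 0)))))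

  fromℤ-- : ∀ i j → fromℤ (i ℤ.- j) ≡ fromℤ i - fromℤ j
  fromℤ-- i j = trans (fromℤ-+ i (ℤ.- j)) (cong (_+_ (fromℤ i)) (fromℤ-neg j))

  fromℤ-mono-≤ : ∀ {i j} → i ℤ.≤ j → fromℤ i ≤ fromℤ j
  fromℤ-mono-≤ {i} {j} p = toℚᵘ-cancel-≤ (ℚᵘ.≤-trans (ℚᵘ.≤-reflexive (toℚᵘ-/ i 0)) (ℚᵘ.≤-trans
    (ℚᵘ.*≤* (ℤ.*-monoʳ-≤-nonNeg (+ 1) p)) (ℚᵘ.≤-reflexive (ℚᵘ.≃-sym (toℚᵘ-/ j 0)))))

  /-cancel : ∀ i k → (i / ℕ.suc k) * fromℤ (+ ℕ.suc k) ≡ fromℤ i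
  /-cancel i k = toℚᵘ-injective (ℚᵘ.≃-trans (toℚᵘ-homo-* (i / ℕ.suc k) (fromℤ (+ ℕ.suc k)))
    (ℚᵘ.≃-trans (ℚᵘ.*-cong (toℚᵘ-/ i k) (toℚᵘ-/ (+ ℕ.suc k) 0)) (ℚᵘ.≃-trans
      (ℚᵘ.*≡* (trans (ℤ.*-identityʳ _) (cong (λ d → i ℤ.* + d) (sym (ℕ.*-identityʳ (ℕ.suc k))))))
      (ℚᵘ.≃-sym (toℚᵘ-/ i 0)))))

  -- An explicit reciprocal `u` of the norm rules out the branch of `inv` with value 0 and removes
  -- the division from the other one.
  inv-by : ∀ a b u → (a * a - 2ℚ * (b * b)) * u ≡ 1ℚ → inv ⟨ a , b ⟩ ≡ ⟨ a * u , - b * u ⟩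
  inv-by a b u nu≡1 with (a * a - (1ℚ + 1ℚ) * (b * b)) ≟ 0ℚ
  ... | yes n≡0 = contradiction (trans (sym (*-zeroˡ u)) (trans (cong (_* u) (sym n≡0)) nu≡1)) λ ()
  ... | no n≢0 = cong (λ v → ⟨ a * v , - b * v ⟩) (begin
    1/ nrm               ≡⟨ *-identityʳ (1/ nrm) ⟨
    1/ nrm * 1ℚ          ≡⟨ cong (1/ nrm *_) nu≡1 ⟨
    1/ nrm * (nrm * u)   ≡⟨ *-assoc (1/ nrm) nrm u ⟨
    1/ nrm * nrm * u     ≡⟨ cong (_* u) (*-inverseˡ nrm) ⟩
    1ℚ * u               ≡⟨ *-identityˡ u ⟩
    u                    ∎)
    where
    open ≡-Reasoning
    nrm = a * a - (1ℚ + 1ℚ) * (b * b)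
    instance _ = ≢-nonZero n≢0

  -- 1/((2 - √2) n) = (1 + √2/2)/n.
  normalisedIso-eq : ∀ n ι → fromℤ (+ n) * ι ≡ 1ℚ → normalisedIso n ≡ ⟨ iso (J2 n) * ι , ½ * (iso (J2 n) * ι) ⟩
  normalisedIso-eq n ι Nι≡1 = trans (cong (embed r ⊗_) inverse) (cong₂ ⟨_,_⟩ (eq₁ r ι) (eq₂ r ι))
    where
    r = iso (J2 n)
    N = fromℤ (+ n)
    x : ℚ√2
    x = (embed 2ℚ ⊖ √2) ⊗ embed N
    eqᵃ : ∀ N → (2ℚ - 0ℚ) * N + 2ℚ * ((0ℚ - 1ℚ) * 0ℚ) ≡ 2ℚ * N
    eqᵃ = solve-∀ ℚ-ring
    eqᵇ : ∀ N → (2ℚ - 0ℚ) * 0ℚ + (0ℚ - 1ℚ) * N ≡ - N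
    eqᵇ = solve-∀ ℚ-ring
    x≡ : x ≡ ⟨ 2ℚ * N , - N ⟩
    x≡ = cong₂ ⟨_,_⟩ (eqᵃ N) (eqᵇ N)
    norm : ∀ N ι → (2ℚ * N * (2ℚ * N) - 2ℚ * (- N * - N)) * (½ * (ι * ι)) ≡ N * ι * (N * ι)
    norm = solve-∀ ℚ-ring
    re≡ : 2ℚ * N * (½ * (ι * ι)) ≡ ι
    re≡ = trans (eq N ι) (trans (cong (_* ι) Nι≡1) (*-identityˡ ι))
      where
      eq : ∀ N ι → 2ℚ * N * (½ * (ι * ι)) ≡ N * ι * ι
      eq = solve-∀ ℚ-ring
    ir≡ : - (- N) * (½ * (ι * ι)) ≡ ½ * ι
    ir≡ = trans (eq N ι) (trans (cong (λ u → ½ * (u * ι)) Nι≡1) (cong (½ *_) (*-identityˡ ι)))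
      where
      eq : ∀ N ι → - (- N) * (½ * (ι * ι)) ≡ ½ * (N * ι * ι)
      eq = solve-∀ ℚ-ring
    inverse : inv x ≡ ⟨ ι , ½ * ι ⟩
    inverse = trans (cong inv x≡) (trans
      (inv-by (2ℚ * N) (- N) (½ * (ι * ι)) (trans (norm N ι) (cong₂ _*_ Nι≡1 Nι≡1)))
      (cong₂ ⟨_,_⟩ re≡ ir≡))
    eq₁ : ∀ r ι → r * ι + 2ℚ * (0ℚ * (½ * ι)) ≡ r * ι
    eq₁ = solve-∀ ℚ-ring
    eq₂ : ∀ r ι → r * (½ * ι) + 0ℚ * ι ≡ ½ * (r * ι)
    eq₂ = solve-∀ ℚ-ring

  AbsLt-by : ∀ {x ρ ε} → x ≡ ⟨ ρ , ½ * ρ ⟩ → Positive (⟨ ρ - 1ℚ - - ε , ½ * ρ ⟩) → Positive (⟨ ε - (ρ - 1ℚ) , - (½ * ρ) ⟩) →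
    AbsLt (x ⊖ embed 1ℚ) ε
  AbsLt-by {ρ = ρ} {ε} refl lower upper =
    subst (λ b → Positive ⟨ ρ - 1ℚ - - ε , b ⟩) (eq₁ ρ) lower , subst (λ b → Positive ⟨ ε - (ρ - 1ℚ) , b ⟩) (eq₂ ρ) upper
    where
    eq₁ : ∀ ρ → ½ * ρ ≡ ½ * ρ - 0ℚ - 0ℚ
    eq₁ = solve-∀ ℚ-ring
    eq₂ : ∀ ρ → - (½ * ρ) ≡ 0ℚ - (½ * ρ - 0ℚ)
    eq₂ = solve-∀ ℚ-ring

-- The isoperimetric number and its asymptotics

module Isoperimetry where
  open EdgeCuts
  open Estimates
  open import Defs hiding (_⊕_; _⊗_; inv; _⊘_; √2; _+_√2; Positive)
  open import Data.Bool using (Bool; true; if_then_else_)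
  open import Data.Integer using (0ℤ; +_; -[1+_]; +[1+_])
  import Data.Integer as ℤ
  import Data.Integer.Properties as ℤ
  import Data.Integer.Tactic.RingSolver as ℤ
  import Data.Nat as ℕ
  open ℕ using (ℕ; suc)
  import Data.Nat.Properties as ℕ
  open import Data.Rational hiding (Positive)
  open import Data.Rational.Properties
  open import Data.List using (List; []; _∷_; length)
  open import Data.List.Membership.Propositional using (_∈_; find; lose)
  open import Data.List.Membership.Propositional.Properties using (∈-concatMap⁺; ∈-concatMap⁻)
  open import Data.List.Relation.Unary.Any using (here; there)
  open import Data.List.Relation.Ternary.Interleaving.Propositional using (Interleaving)
  open import Data.Product using (∃; _×_; _,_; proj₁; proj₂)
  open import Data.Sum using ([_,_]′)
  open import Relation.Nullary using (Dec; does; yes; no; contradiction)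
  open import Relation.Nullary.Decidable using (dec-true)
  open import Relation.Binary.PropositionalEquality
  open import Tactic.RingSolver using (solve-∀)

  minimum-≤ : ∀ {q qs} → q ∈ qs → minimum qs ≤ q
  minimum-≤ {qs = _ ∷ []} (here refl) = ≤-refl
  minimum-≤ {qs = q ∷ qs@(_ ∷ _)} (here refl) = p⊓q≤p q (minimum qs)
  minimum-≤ {qs = q ∷ qs@(_ ∷ _)} (there i) = ≤-trans (p⊓q≤q q (minimum qs)) (minimum-≤ i)

  minimum-∷-∈ : ∀ q qs → minimum (q ∷ qs) ∈ q ∷ qs
  minimum-∷-∈ q [] = here refl
  minimum-∷-∈ q (q′ ∷ qs) = [ here , (λ e → there (subst (_∈ q′ ∷ qs) (sym e) (minimum-∷-∈ q′ qs))) ]′ (⊓-sel q (minimum (q′ ∷ qs)))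

  minimum-∈ : ∀ {q qs} → q ∈ qs → minimum qs ∈ qs
  minimum-∈ {qs = q ∷ qs} _ = minimum-∷-∈ q qs

  ∈-if : {A : Set} {x y : A} (b : Bool) → x ∈ (if b then y ∷ [] else []) → b ≡ true × x ≡ y
  ∈-if true (here e) = refl , e

  does⇒ : {P : Set} (p? : Dec P) → does p? ≡ true → P
  does⇒ (yes p) _ = p

  module _ (G : FinGraph) where
    open FinGraph G

    record Cut (q : ℚ) : Set where
      field
        {S T′}  : List V
        {size-1} : ℕ
        split : Interleaving S T′ verts
        size  : length S ≡ suc size-1
        small : 2 ℕ.* length S ℕ.≤ length verts
        value : q ≡ (+ boundarySize G (S , T′)) / suc size-1

    private
      value-of : List V × List V → List ℚ
      value-of p = if admissible (length verts) (length (proj₁ p)) then ratio (boundarySize G p) (length (proj₁ p)) ∷ [] else []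

      -- The length is abstracted to `l`, so that a match on it reduces both `admissible` and
      -- `ratio`.
      decide : ∀ S T l → length S ≡ l → Interleaving S T verts → ∀ {q} →
        q ∈ (if admissible (length verts) l then ratio (boundarySize G (S , T)) l ∷ [] else []) → Cut q
      decide S T (suc k) e i q∈ = record
        { split = i
        ; size = e
        ; small = subst (λ l → 2 ℕ.* l ℕ.≤ length verts) (sym e) (does⇒ (2 ℕ.* suc k ℕ.≤? length verts) (proj₁ chosen))
        ; value = proj₂ chosen
        }
        where chosen = ∈-if (admissible (length verts) (suc k)) q∈

    candidate⇒cut : ∀ {q} → q ∈ candidates G → Cut q
    candidate⇒cut q∈ with find (∈-concatMap⁻ value-of q∈)
    ... | (S , T) , ST∈ , q∈v = decide S T (length S) refl (splits⇒interleaving verts ST∈) q∈v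

    cut⇒candidate : ∀ {q} → Cut q → q ∈ candidates G
    cut⇒candidate {q} c = ∈-concatMap⁺ value-of (lose (interleaving⇒splits split) member)
      where
      open Cut c
      member : q ∈ value-of (S , T′)
      member rewrite size | dec-true (2 ℕ.* suc size-1 ℕ.≤? length verts) (subst (λ l → 2 ℕ.* l ℕ.≤ length verts) size small) = here value

    iso-≤ : ∀ {q} → Cut q → iso G ≤ q
    iso-≤ c = minimum-≤ (cut⇒candidate c)

    -- Some cut must be given: it shows that there are candidates, so that `iso` is an attained
    -- minimum and not the default value 0.
    iso-cut : ∀ {q} → Cut q → Cut (iso G)
    iso-cut c = candidate⇒cut (minimum-∈ (cut⇒candidate c))

  last-≤ : ∀ (f : ℕ → ℕ) M n → f 0 ℕ.≤ M → M ℕ.< f (suc n) → ∃ λ k → k ℕ.≤ n × f k ℕ.≤ M × M ℕ.< f (suc k)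
  last-≤ f M 0 f0≤M M<f = 0 , ℕ.z≤n , f0≤M , M<f
  last-≤ f M (suc n) f0≤M M<f with f (suc n) ℕ.≤? M
  ... | yes p = suc n , ℕ.≤-refl , p , M<f
  ... | no p with last-≤ f M n f0≤M (ℕ.≰⇒> p)
  ...   | k , k≤n , r = k , ℕ.m≤n⇒m≤1+n k≤n , r

  -- k is about n/√2, so that a k-clique has just under half of the edges.
  clique-size : ∀ n → 2 ℕ.≤ n → ∃ λ k → k ℕ.≤ n ×
    + 2 ℤ.* (+ k ℤ.* (+ k ℤ.- + 1)) ℤ.≤ + n ℤ.* (+ n ℤ.- + 1) ×
    + n ℤ.* (+ n ℤ.- + 1) ℤ.≤ + 2 ℤ.* (+ k ℤ.* (+ k ℤ.+ + 1)) ×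
    + n ℤ.≤ + 2 ℤ.* + k
  clique-size n@(suc n-1) 2≤n with last-≤ (λ k → 2 ℕ.* (k ℕ.* ℕ.pred k)) (n ℕ.* n-1) n ℕ.z≤n
    (ℕ.≤-trans (ℕ.*-monoʳ-< n (ℕ.n<1+n n-1)) (ℕ.≤-trans (ℕ.m≤n+m (n ℕ.* n) n) (ℕ.m≤m+n (suc n ℕ.* n) _)))
  ... | k , k≤n , lo , hi = k , k≤n , lo′ , hi′ , ℤ.≮⇒≥ λ 2k<n → ℤ≤.≮0
      (ℤ≤.0≤+ (ℤ≤.0≤* (ℤ≤.0≤const 2) (ℤ≤.gap hi′)) (ℤ≤.0≤+ (ℤ≤.0≤* (ℤ≤.gap (ℤ.i<j⇒suc[i]≤j 2k<n)) (ℤ≤.0≤+ (ℤ≤.0≤+ (ℤ≤.0≤const n) (ℤ≤.0≤* (ℤ≤.0≤const 2) (ℤ≤.0≤const k))) (ℤ≤.0≤const 1)))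
        (ℤ≤.0≤* (ℤ≤.gap (ℤ.+≤+ 2≤n)) (ℤ≤.0≤const n)))) (eq (+ n) (+ k))
    where
    eq : ∀ n k → + 2 ℤ.* (+ 2 ℤ.* (k ℤ.* (k ℤ.+ + 1)) ℤ.- n ℤ.* (n ℤ.- + 1)) ℤ.+
      ((n ℤ.- (+ 1 ℤ.+ + 2 ℤ.* k)) ℤ.* (n ℤ.+ + 2 ℤ.* k ℤ.+ + 1) ℤ.+ (n ℤ.- + 2) ℤ.* n) ≡ ℤ.-1ℤ
    eq = ℤ.solve-∀
    falling : ∀ j → + (j ℕ.* ℕ.pred j) ≡ + j ℤ.* (+ j ℤ.- + 1)
    falling 0 = refl
    falling (suc j) = ℤ.pos-* (suc j) j
    lo′ : + 2 ℤ.* (+ k ℤ.* (+ k ℤ.- + 1)) ℤ.≤ + n ℤ.* (+ n ℤ.- + 1)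
    lo′ = subst₂ ℤ._≤_ (trans (ℤ.pos-* 2 (k ℕ.* ℕ.pred k)) (cong (+ 2 ℤ.*_) (falling k))) (falling n) (ℤ.+≤+ lo)
    hi′ : + n ℤ.* (+ n ℤ.- + 1) ℤ.≤ + 2 ℤ.* (+ k ℤ.* (+ k ℤ.+ + 1))
    hi′ = subst₂ ℤ._≤_ (falling n) (trans (ℤ.pos-* 2 (suc k ℕ.* k)) (cong (+ 2 ℤ.*_) (trans (ℤ.pos-* (suc k) k)
      (trans (ℤ.*-comm (+ suc k) (+ k)) (cong (+ k ℤ.*_) (trans (ℤ.pos-+ 1 k) (ℤ.+-comm (+ 1) (+ k)))))))) (ℤ.+≤+ (ℕ.<⇒≤ hi))

  -- The denominator serves as `c`: its product with `ε` is the numerator, a positive integer.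
  denominator-bound : ∀ {ε} → 0ℚ < ε → ∃ λ c → 1ℚ ≤ fromℤ (+ c) * ε
  denominator-bound {ε@(mkℚ +[1+ p ] q _)} _ = suc q , subst (1ℚ ≤_) eq (fromℤ-mono-≤ {+ 1} {+[1+ p ]} (ℤ.+≤+ (ℕ.s≤s ℕ.z≤n)))
    where
    eq : fromℤ (+[1+ p ]) ≡ fromℤ (+ suc q) * ε
    eq = trans (sym (/-cancel +[1+ p ] q)) (trans (*-comm (+[1+ p ] / suc q) (fromℤ (+ suc q))) (cong (fromℤ (+ suc q) *_) (fromℚᵘ-toℚᵘ ε)))
  denominator-bound {mkℚ (+ 0) _ _} (*<* (ℤ.+<+ ()))
  denominator-bound {mkℚ -[1+ _ ] _ _} (*<* ())

  module Reciprocal (n-1 : ℕ) where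
    ι : ℚ
    ι = (+ 1) / suc n-1

    inverse : fromℤ (+ suc n-1) * ι ≡ 1ℚ
    inverse = trans (*-comm (fromℤ (+ suc n-1)) ι) (/-cancel (+ 1) n-1)

    0<ι : 0ℚ < ι
    0<ι = positive⁻¹ ι {{normalize-pos 1 (suc n-1)}}

  /-unique : ∀ {p} i k → p * fromℤ (+ suc k) ≡ fromℤ i → p ≡ i / suc k
  /-unique {p} i k e = begin
    p                    ≡⟨ *-identityʳ p ⟨
    p * 1ℚ               ≡⟨ cong (p *_) inverse ⟨
    p * (M * ι)          ≡⟨ *-assoc p M ι ⟨
    p * M * ι            ≡⟨ cong (_* ι) (trans e (sym (/-cancel i k))) ⟩
    (i / suc k) * M * ι  ≡⟨ *-assoc (i / suc k) M ι ⟩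
    (i / suc k) * (M * ι) ≡⟨ cong ((i / suc k) *_) inverse ⟩
    (i / suc k) * 1ℚ     ≡⟨ *-identityʳ (i / suc k) ⟩
    i / suc k            ∎
    where
    open ≡-Reasoning
    open Reciprocal k
    M = fromℤ (+ suc k)

  clique-cut : ∀ n k → k ℕ.≤ n → 8 ℕ.≤ n → + 2 ℤ.* (+ k ℤ.* (+ k ℤ.- + 1)) ℤ.≤ + n ℤ.* (+ n ℤ.- + 1) → + n ℤ.≤ + 2 ℤ.* + k →
    Cut (J2 n) (2ℚ * (fromℤ (+ n) - fromℤ (+ k)))
  clique-cut n k k≤n 8≤n lo n≤2k = cut (length S) refl
    where
    open Clique n k k≤n
    eq₀ : ∀ n k l → + 2 ℤ.* l ≡ k ℤ.* (k ℤ.- + 1) → l ≡ + 0 →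
      (+ 2 ℤ.* k ℤ.- n) ℤ.* (k ℤ.+ + 3) ℤ.+ ((n ℤ.- + 8) ℤ.* (k ℤ.+ + 3) ℤ.+ + 23) ≡ ℤ.-1ℤ
    eq₀ n k l e refl = trans (eq n k) (cong (λ z → + 2 ℤ.* z ℤ.- + 1) (sym e))
      where
      eq : ∀ n k → (+ 2 ℤ.* k ℤ.- n) ℤ.* (k ℤ.+ + 3) ℤ.+ ((n ℤ.- + 8) ℤ.* (k ℤ.+ + 3) ℤ.+ + 23) ≡ + 2 ℤ.* (k ℤ.* (k ℤ.- + 1)) ℤ.- + 1
      eq = ℤ.solve-∀
    half : 2 ℕ.* length S ℕ.≤ length (pairs n)
    half = ℤ.drop‿+≤+ (ℤ.*-cancelˡ-≤-pos (+ (2 ℕ.* length S)) (+ length (pairs n)) (+ 2)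
      (ℤ.≤-trans (ℤ.≤-reflexive (cong (+ 2 ℤ.*_) (trans (ℤ.pos-* 2 (length S)) 2length-clique)))
        (ℤ.≤-trans lo (ℤ.≤-reflexive (sym (length-pairs n))))))
    cut : ∀ l → length S ≡ l → Cut (J2 n) (2ℚ * (fromℤ (+ n) - fromℤ (+ k)))
    -- An empty clique would give `k (k - 1) = 0`, but `8 ≤ n ≤ 2k` forces `k ≥ 4`.
    cut 0 e = contradiction (ℤ≤.0≤+ (ℤ≤.0≤* (ℤ≤.gap n≤2k) 0≤k+3) (ℤ≤.0≤+ (ℤ≤.0≤* (ℤ≤.gap (ℤ.+≤+ 8≤n)) 0≤k+3) (ℤ≤.0≤const 23)))
      λ q → ℤ≤.≮0 q (eq₀ (+ n) (+ k) (+ length S) 2length-clique (cong +_ e))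
      where 0≤k+3 = ℤ≤.0≤+ (ℤ≤.0≤const k) (ℤ≤.0≤const 3)
    cut (suc l) e = record { split = split ; size = e ; small = half ; value = /-unique (+ boundarySize (J2 n) (S , T)) l value }
      where
      value : 2ℚ * (fromℤ (+ n) - fromℤ (+ k)) * fromℤ (+ suc l) ≡ fromℤ (+ boundarySize (J2 n) (S , T))
      value = sym (trans (cong fromℤ boundary-clique) (trans (fromℤ-* (+ 2 ℤ.* (+ n ℤ.- + k)) (+ length S))
        (cong₂ _*_ (trans (fromℤ-* (+ 2) (+ n ℤ.- + k)) (cong (2ℚ *_) (fromℤ-- (+ n) (+ k)))) (cong (λ l → fromℤ (+ l)) e))))

  -- Division of `b = 2 (n - 1) m - a` by `m n`, with `α = a/(m n)`. That `α` is at most √2 is kept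
  -- in squared form.
  ratio-bound : ∀ n-1 size-1 (let n = suc n-1; m = suc size-1) {r b a} → r ≡ b / m → 0ℤ ℤ.≤ a →
    a ℤ.* a ℤ.≤ + 2 ℤ.* (+ n ℤ.* + n ℤ.* (+ m ℤ.* + m)) → b ≡ (+ n ℤ.- + 1) ℤ.* (+ 2 ℤ.* + m) ℤ.- a →
    let open Reciprocal n-1 in ∃ λ α → 0ℚ ≤ α × α * α ≤ 2ℚ × r * ι ≡ 2ℚ - 2ℚ * ι - α
  ratio-bound n-1 size-1 {r} {b} {a} value 0≤a a²≤ b≡ = α , 0≤α , α²≤2 , rι≡
    where
    open Reciprocal n-1
    open Reciprocal size-1 renaming (ι to μ; 0<ι to 0<μ; inverse to inverseᵐ)
    n = suc n-1
    m = suc size-1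
    N = fromℤ (+ n)
    M = fromℤ (+ m)
    a′ = fromℤ a
    α = a′ * (μ * ι)
    0≤μι : 0ℚ ≤ μ * ι
    0≤μι = 0≤* (<⇒≤ 0<μ) (<⇒≤ 0<ι)
    0≤α : 0ℚ ≤ α
    0≤α = 0≤* (fromℤ-mono-≤ 0≤a) 0≤μι
    a′²≤ : a′ * a′ ≤ 2ℚ * (N * N * (M * M))
    a′²≤ = subst₂ _≤_ (fromℤ-* a a) (trans (fromℤ-* (+ 2) (+ n ℤ.* + n ℤ.* (+ m ℤ.* + m)))
      (cong (2ℚ *_) (trans (fromℤ-* (+ n ℤ.* + n) (+ m ℤ.* + m)) (cong₂ _*_ (fromℤ-* (+ n) (+ n)) (fromℤ-* (+ m) (+ m))))))
      (fromℤ-mono-≤ a²≤)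
    α²≤2 : α * α ≤ 2ℚ
    α²≤2 = ≤-by (0≤* (gap a′²≤) (0≤sq (μ * ι))) (trans
      (cong₂ (λ x y → 2ℚ * (x * x * (y * y)) - α * α) (sym inverse) (sym inverseᵐ)) (eq N ι M μ a′))
      where
      eq : ∀ N ι M μ a → 2ℚ * (N * ι * (N * ι) * (M * μ * (M * μ))) - a * (μ * ι) * (a * (μ * ι)) ≡
        (2ℚ * (N * N * (M * M)) - a * a) * (μ * ι * (μ * ι))
      eq = solve-∀ ℚ-ring
    rM≡ : r * M ≡ (N - 1ℚ) * (2ℚ * M) - a′
    rM≡ = trans (cong (_* M) value) (trans (/-cancel b size-1) (trans (cong fromℤ b≡)
      (trans (fromℤ-- ((+ n ℤ.- + 1) ℤ.* (+ 2 ℤ.* + m)) a) (cong (_- a′)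
        (trans (fromℤ-* (+ n ℤ.- + 1) (+ 2 ℤ.* + m)) (cong₂ _*_ (fromℤ-- (+ n) (+ 1)) (fromℤ-* (+ 2) (+ m))))))))
    rι≡ : r * ι ≡ 2ℚ - 2ℚ * ι - α
    rι≡ = begin
      r * ι                                        ≡⟨ cong (_* ι) (*-identityʳ r) ⟨
      r * 1ℚ * ι                                   ≡⟨ cong (λ u → r * u * ι) inverseᵐ ⟨
      r * (M * μ) * ι                              ≡⟨ eq₁ r M μ ι ⟩
      r * M * (μ * ι)                              ≡⟨ cong (_* (μ * ι)) rM≡ ⟩
      ((N - 1ℚ) * (2ℚ * M) - a′) * (μ * ι)         ≡⟨ eq₂ N M μ ι a′ ⟩
      2ℚ * (N * ι) * (M * μ) - 2ℚ * (M * μ) * ι - α ≡⟨ cong₂ (λ x y → 2ℚ * x * y - 2ℚ * y * ι - α) inverse inverseᵐ ⟩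
      2ℚ * 1ℚ * 1ℚ - 2ℚ * 1ℚ * ι - α               ≡⟨ eq₃ ι α ⟩
      2ℚ - 2ℚ * ι - α                              ∎
      where
      open ≡-Reasoning
      eq₁ : ∀ r M μ ι → r * (M * μ) * ι ≡ r * M * (μ * ι)
      eq₁ = solve-∀ ℚ-ring
      eq₂ : ∀ N M μ ι a → ((N - 1ℚ) * (2ℚ * M) - a) * (μ * ι) ≡ 2ℚ * (N * ι) * (M * μ) - 2ℚ * (M * μ) * ι - a * (μ * ι)
      eq₂ = solve-∀ ℚ-ring
      eq₃ : ∀ ι α → 2ℚ * 1ℚ * 1ℚ - 2ℚ * 1ℚ * ι - α ≡ 2ℚ - 2ℚ * ι - α
      eq₃ = solve-∀ ℚ-ring

  cut-bound : ∀ n-1 {r} → Cut (J2 (suc n-1)) r → let open Reciprocal n-1 in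
    ∃ λ α → 0ℚ ≤ α × α * α ≤ 2ℚ × r * ι ≡ 2ℚ - 2ℚ * ι - α
  cut-bound n-1 c =
    let a , 0≤a , a²≤ , b≡ = boundary-lower split small
        m≡ = cong +_ size
    in ratio-bound n-1 size-1 value 0≤a
         (subst (λ m → a ℤ.* a ℤ.≤ + 2 ℤ.* (+ suc n-1 ℤ.* + suc n-1 ℤ.* (m ℤ.* m))) m≡ a²≤)
         (trans b≡ (cong (λ m → (+ suc n-1 ℤ.- + 1) ℤ.* (+ 2 ℤ.* m) ℤ.- a) m≡))
    where open Cut c

  -- As `1/ε ≤ C`, it suffices that `N` is at least 8, `8C` and `8C²`. The single threshold
  -- `8C² + 8` covers all three; for the second, `8C² + 8 - 8C = 4 (C² + (C - 1)² + 1)`.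
  reciprocal-small : ∀ {N ι C ε} → N * ι ≡ 1ℚ → 0ℚ < ι → 0ℚ < ε → 1ℚ ≤ C * ε → 8ℚ * (C * C) + 8ℚ ≤ N →
    8ℚ * ι ≤ 1ℚ × 8ℚ * ι ≤ ε × 8ℚ * ι ≤ ε * ε
  reciprocal-small {N} {ι} {C} {ε} Nι≡1 0<ι 0<ε 1≤Cε big =
      ≤-by (0≤+ (0≤* (gap big) 0≤ι) (0≤* 0≤8 (0≤* (0≤sq C) 0≤ι)))
        (trans (cong (_- 8ℚ * ι) (sym Nι≡1)) (eq₁ N ι C))
    , ≤-by (0≤+ (0≤* (gap big) (0≤* 0≤ι 0≤ε)) (0≤+ (0≤* (0≤* 0≤4 (0≤+ (0≤+ (0≤sq C) (0≤sq (C - 1ℚ))) (<⇒≤ (positive⁻¹ 1ℚ)))) (0≤* 0≤ι 0≤ε)) (0≤* (0≤* 0≤8 0≤ι) (gap 1≤Cε))))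
        (trans (cong (_- 8ℚ * ι) (trans (sym (*-identityˡ ε)) (cong (_* ε) (sym Nι≡1)))) (eq₂ N ι C ε))
    , ≤-by (0≤+ (0≤* (gap big) (0≤* 0≤ι (0≤sq ε))) (0≤+ (0≤* (0≤* 0≤8 0≤ι) (0≤sq ε)) (0≤* (0≤* (0≤* 0≤8 0≤ι) (gap 1≤Cε)) (0≤+ (gap 1≤Cε) (<⇒≤ 0<2ℚ)))))
        (trans (cong (_- 8ℚ * ι) (trans (sym (*-identityˡ (ε * ε))) (cong (_* (ε * ε)) (sym Nι≡1)))) (eq₃ N ι C ε))
    where
    0≤ι = <⇒≤ 0<ι
    0≤ε = <⇒≤ 0<ε
    0≤8 = nonNegative⁻¹ 8ℚ
    0≤4 = nonNegative⁻¹ 4ℚ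
    eq₁ : ∀ N ι C → N * ι - 8ℚ * ι ≡ (N - (8ℚ * (C * C) + 8ℚ)) * ι + 8ℚ * (C * C * ι)
    eq₁ = solve-∀ ℚ-ring
    eq₂ : ∀ N ι C ε → N * ι * ε - 8ℚ * ι ≡ (N - (8ℚ * (C * C) + 8ℚ)) * (ι * ε) +
      (4ℚ * (C * C + (C - 1ℚ) * (C - 1ℚ) + 1ℚ) * (ι * ε) + 8ℚ * ι * (C * ε - 1ℚ))
    eq₂ = solve-∀ ℚ-ring
    eq₃ : ∀ N ι C ε → N * ι * (ε * ε) - 8ℚ * ι ≡ (N - (8ℚ * (C * C) + 8ℚ)) * (ι * (ε * ε)) +
      (8ℚ * ι * (ε * ε) + 8ℚ * ι * (C * ε - 1ℚ) * ((C * ε - 1ℚ) + 2ℚ))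
    eq₃ = solve-∀ ℚ-ring

  -- Maximality of `k`, divided by `n²`, reads `1 - ι ≤ 2κ² + 2κι`. With `κ ≤ 1` this gives the
  -- error `3ι`.
  clique-density : ∀ n-1 k → k ℕ.≤ suc n-1 → (let n = suc n-1) →
    + n ℤ.* (+ n ℤ.- + 1) ℤ.≤ + 2 ℤ.* (+ k ℤ.* (+ k ℤ.+ + 1)) → + n ℤ.≤ + 2 ℤ.* + k →
    let open Reciprocal n-1; κ = fromℤ (+ k) * ι in
    κ ≤ 1ℚ × 1ℚ ≤ 2ℚ * κ × 1ℚ ≤ 2ℚ * (κ * κ) + 3ℚ * ι × (2ℚ * (fromℤ (+ n) - fromℤ (+ k))) * ι ≡ 2ℚ - 2ℚ * κ
  clique-density n-1 k k≤n hi n≤2k =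
      κ≤1
    , ≤-by (0≤* (gap N≤2K) 0≤ι) (trans (cong (_-_ (2ℚ * κ)) (sym inverse)) (eq₂ N ι K))
    , ≤-by (0≤+ (0≤* (gap hi′) (0≤sq ι)) (0≤* (0≤* (<⇒≤ 0<2ℚ) 0≤ι) (gap κ≤1)))
        (trans (cong (λ u → 2ℚ * (κ * κ) + 3ℚ * ι - u) (sym (cong₂ _*_ inverse inverse)))
          (trans (cong (λ u → 2ℚ * (κ * κ) + u - N * ι * (N * ι)) (trans (split-3 ι) (cong (λ u → u * ι + 2ℚ * ι) (sym inverse)))) (eq₃ N ι K)))
    , trans (eq₄ N ι K) (cong (λ u → 2ℚ * u - 2ℚ * κ) inverse)
    where
    open Reciprocal n-1
    n = suc n-1
    N = fromℤ (+ n)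
    K = fromℤ (+ k)
    κ = K * ι
    0≤ι = <⇒≤ 0<ι
    N≤2K : N ≤ 2ℚ * K
    N≤2K = subst (N ≤_) (fromℤ-* (+ 2) (+ k)) (fromℤ-mono-≤ n≤2k)
    hi′ : N * (N - 1ℚ) ≤ 2ℚ * (K * (K + 1ℚ))
    hi′ = subst₂ _≤_ (trans (fromℤ-* (+ n) (+ n ℤ.- + 1)) (cong (N *_) (fromℤ-- (+ n) (+ 1))))
      (trans (fromℤ-* (+ 2) (+ k ℤ.* (+ k ℤ.+ + 1))) (cong (2ℚ *_) (trans (fromℤ-* (+ k) (+ k ℤ.+ + 1)) (cong (K *_) (fromℤ-+ (+ k) (+ 1))))))
      (fromℤ-mono-≤ hi)
    κ≤1 : κ ≤ 1ℚ
    κ≤1 = ≤-by (0≤* (gap (fromℤ-mono-≤ (ℤ.+≤+ k≤n))) 0≤ι) (trans (cong (_- κ) (sym inverse)) (eq₁ N ι K))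
      where
      eq₁ : ∀ N ι K → N * ι - K * ι ≡ (N - K) * ι
      eq₁ = solve-∀ ℚ-ring
    eq₂ : ∀ N ι K → 2ℚ * (K * ι) - N * ι ≡ (2ℚ * K - N) * ι
    eq₂ = solve-∀ ℚ-ring
    split-3 : ∀ ι → 3ℚ * ι ≡ 1ℚ * ι + 2ℚ * ι
    split-3 = solve-∀ ℚ-ring
    eq₃ : ∀ N ι K → 2ℚ * (K * ι * (K * ι)) + (N * ι * ι + 2ℚ * ι) - N * ι * (N * ι) ≡
      (2ℚ * (K * (K + 1ℚ)) - N * (N - 1ℚ)) * (ι * ι) + 2ℚ * ι * (1ℚ - K * ι)
    eq₃ = solve-∀ ℚ-ring
    eq₄ : ∀ N ι K → 2ℚ * (N - K) * ι ≡ 2ℚ * (N * ι) - 2ℚ * (K * ι)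
    eq₄ = solve-∀ ℚ-ring

  -- The clique is used twice: its value bounds `iso` from above, and its existence yields an
  -- optimal cut, to which the lower bound applies.
  estimate : ∀ {ε} c → 0ℚ < ε → 1ℚ ≤ fromℤ (+ c) * ε → ∀ n-1 → (let n = suc n-1) → 2 ℕ.≤ n →
    8 ℕ.* (c ℕ.* c) ℕ.+ 8 ℕ.≤ n → AbsLt (normalisedIso n ⊖ embed 1ℚ) ε
  estimate {ε} c 0<ε 1≤cε n-1 2≤n big =
    let k , k≤n , lo , hi , n≤2k = clique-size n 2≤n
        cut = clique-cut n k k≤n (ℕ.≤-trans (ℕ.m≤n+m 8 (8 ℕ.* (c ℕ.* c))) big) lo n≤2k
        κ≤1 , 1≤2κ , 1≤2κ²+3ι , r₀ι≡ = clique-density n-1 k k≤n hi n≤2k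
        α , 0≤α , α²≤2 , rι≡ = cut-bound n-1 (iso-cut (J2 n) cut)
        8ι≤1 , 8ι≤ε , 8ι≤ε² = reciprocal-small {C = fromℤ (+ c)} inverse 0<ι 0<ε 1≤cε big′
        open LowerEstimate 0<ι 0<ε 8ι≤ε 8ι≤ε² 8ι≤1 0≤α α²≤2 using (0<ρ; positive-lower)
        ρ≤ = subst (iso (J2 n) * ι ≤_) r₀ι≡ (*-monoʳ-≤-nonNeg ι {{nonNegative (<⇒≤ 0<ι)}} (iso-≤ (J2 n) cut))
    in AbsLt-by (normalisedIso-eq n ι inverse)
         (subst (λ ρ → Positive-lower ρ) (sym rι≡) positive-lower)
         (positive-upper 0<ι 0<ε 8ι≤ε² κ≤1 1≤2κ 1≤2κ²+3ι (subst (0ℚ <_) (sym rι≡) 0<ρ) ρ≤)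
    where
    n = suc n-1
    open Reciprocal n-1
    Positive-lower : ℚ → Set
    Positive-lower ρ = Defs.Positive (Defs._+_√2 (ρ - 1ℚ - - ε) (½ * ρ))
    big′ : 8ℚ * (fromℤ (+ c) * fromℤ (+ c)) + 8ℚ ≤ fromℤ (+ n)
    big′ = subst (_≤ fromℤ (+ n)) (trans (cong fromℤ (trans (ℤ.pos-+ (8 ℕ.* (c ℕ.* c)) 8) (cong (ℤ._+ + 8) (trans (ℤ.pos-* 8 (c ℕ.* c)) (cong (+ 8 ℤ.*_) (ℤ.pos-* c c))))))
      (trans (fromℤ-+ (+ 8 ℤ.* (+ c ℤ.* + c)) (+ 8)) (cong (_+ 8ℚ) (trans (fromℤ-* (+ 8) (+ c ℤ.* + c)) (cong (8ℚ *_) (fromℤ-* (+ c) (+ c)))))))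
      (fromℤ-mono-≤ (ℤ.+≤+ big))

open import Data.Nat using (ℕ; suc; _≤_; _+_; _*_)
open import Data.Rational using (ℚ; 0ℚ; 1ℚ; _<_)
open import Data.Product using (Σ; _,_)
open Isoperimetry using (denominator-bound; estimate)

theorem2 : (ε : ℚ) → 0ℚ < ε →
    Σ ℕ (λ N → (n : ℕ) → 2 ≤ n → N ≤ n →
      AbsLt (normalisedIso n ⊖ embed 1ℚ) ε)
theorem2 ε 0<ε =
  let c , 1≤cε = denominator-bound 0<ε
  in 8 * (c * c) + 8 , λ { (suc n-1) 2≤n large → estimate c 0<ε 1≤cε n-1 2≤n large }
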